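{- The theory $\mathcal{T_M}^+$ (defined in the context) proves the following mathematical statement. Let $U$ be a map from $X$ to $X$ and $(u_n)_{n\in\mathbb{N}}$ a sequence of elements of $X$ such that $\lim_nd(U(u_n),u_n)=0$. Consider $F:=Fix(U)$. Given $k\in\mathbb{N}$, $\lambda\in\mathbb{R}$ and $\theta:X\to\mathbb{R}$, if $$\forall y\in F\left(\lambda<\theta(y)+\frac{1}{k+1}\right)$$ then, for $n$ sufficiently large, $$\lambda<\theta(u_n)+\frac{1}{k+1}.$$
   Context: **The theory $\mathcal{T_M}$** (bounded metric spaces). Language: finite types over base types $0$ (natural numbers) and $X$ (abstract metric space); $1:=0\to0$; classical many-sorted logic; the only primitive relation is $=_0$. Constants: combinators; zero, successor, recursors for G\"odel's primitive recursive functionals (all types); $d$ of type $X\to(X\to1)$; $b$ of type $0$ (a positive bound on the diameter of $X$). Reals are represented by type-$1$ functionals in signed digit representation: to each $\gamma^1$ is associated primitive recursively (in the sense of Kleene) a representation $\gamma_{\mathbb{R}}$ of a real; $=_{\mathbb{R}},\leq_{\mathbb{R}}$ are $\Pi^0_1$ and $<_{\mathbb{R}}$ is $\Sigma^0_1$. $\gamma_{[0,1]}:=\max_{\mathbb{R}}(0_{\mathbb{R}},\min_{\mathbb{R}}(1_{\mathbb{R}},\gamma_{\mathbb{R}}))$, with a fixed $l^1$ such that $\gamma_{[0,1]}(n)\leq l(n)$ always; $\forall\gamma\in[0,1](\ldots\gamma\ldots)$ stands for $\forall\gamma^1(\ldots\gamma_{[0,1]}\ldots)$, dually for $\exists$.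 $x=_Xy$ abbreviates $d(x,y)=_{\mathbb{R}}0_{\mathbb{R}}$. Axioms: the usual axioms for combinators and arithmetic constants (full induction scheme); Spector's weak (quantifier-free) extensionality rule; $\forall x^X,y^X\forall n^0(d(x,y)(n)=_0d(x,y)_{\mathbb{R}}(n))$; $d(x,x)=_{\mathbb{R}}0_{\mathbb{R}}$; $d(x,y)=_{\mathbb{R}}d(y,x)$; $d(x,z)\leq_{\mathbb{R}}d(x,y)+d(y,z)$; $d(x,y)\leq_{\mathbb{R}}b_{\mathbb{R}}$. **The theory $\mathcal{T_M}^+$.** Bounded formulas are built from atomic formulas by propositional connectives and the bounded quantifications $\forall k\leq_0n$, $\exists k\leq_0n$, $\forall x^X$, $\exists x^X$, $\forall\gamma\in[0,1]$, $\exists\gamma\in[0,1]$. A $\Sigma$-formula has the form $\exists n^0B(n)$ with $B$ bounded. For $f$ of type $1$, $\tilde f(n):=\max_{k\leq n}f(k)$. $\mathcal{T_M}^+$ is $\mathcal{T_M}$ plus, for all $\Sigma$-formulas $A$ (possibly with parameters): bounded choice $\forall n^0\exists k^0A(n,k)\to\exists f^1\forall n\exists k\leq\tilde f(n)A(n,k)$; and bounded collection $\forall i\leq_0m\exists n^0A(i,n)\to\exists n\forall i\leq m\exists k\leq nA(i,k)$, $\forall\gamma\in[0,1]\exists n^0A(\gamma,n)\to\exists n\forall\gamma\in[0,1]\exists k\leq nA(\gamma,k)$, $\forall x^X\exists n^0A(x,n)\to\exists n\forall x^X\exists k\leq nA(x,k)$. The mathematical statement is understood as formalized in this language: $U$ is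 a variable of type $X\to X$, $(u_n)$ of type $0\to X$, $\theta$ of type $X\to1$ (real-valued via representations), $\lambda$ of type $1$; $x\in Fix(U)$ means $U(x)=_Xx$; $\lim_nd(U(u_n),u_n)=0$ means $\forall r\exists n\forall m\geq n\,(d(U(u_m),u_m)\leq\frac{1}{r+1})$; no extensionality or continuity of $U$, $\theta$ is assumed. -}

module Defs where

open import Data.List using (List; []; _∷_; map)
open import Data.List.Membership.Propositional using (_∈_)
open import Data.List.Relation.Unary.Any using (here; there)
open import Data.Nat using (ℕ; zero; suc)
open import Relation.Binary.PropositionalEquality using (refl)

infixr 7 _⇒_
infixl 9 _·_
infixl 7 _*ₒ_
infixl 6 _+ₒ_ _∸ₒ_ _+ᴿ_
infix  5 _≈_ _≤₀_ _<₀_ _≤ᴿ_ _<ᴿ_ _=ᴿ_ _=ˣ_ _≐_ _∈Fix_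
infixr 4 _∧̇_
infixr 3 _∨̇_
infixr 2 _⊃_
infix  1 _⊢_

------------------------------------------------------------------------
-- Types and terms.  Terms and formulas are intrinsically typed de Bruijn
-- syntax: a context lists the types of the free variables, the most
-- recently bound one first.

data Ty : Set where
  𝟘 𝕏 : Ty
  _⇒_ : Ty → Ty → Ty

𝟙 : Ty
𝟙 = 𝟘 ⇒ 𝟘

Ctx : Set
Ctx = List Ty

private
  variable
    Γ Δ : Ctx
    ρ σ τ : Ty

data Tm (Γ : Ctx) : Ty → Set where
  var : τ ∈ Γ → Tm Γ τ
  _·_ : Tm Γ (σ ⇒ τ) → Tm Γ σ → Tm Γ τ
  K   : Tm Γ (σ ⇒ τ ⇒ σ)
  S   : Tm Γ ((ρ ⇒ σ ⇒ τ) ⇒ (ρ ⇒ σ) ⇒ ρ ⇒ τ)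
  O   : Tm Γ 𝟘
  Suc : Tm Γ (𝟘 ⇒ 𝟘)
  Rec : Tm Γ (𝟘 ⇒ τ ⇒ (τ ⇒ 𝟘 ⇒ τ) ⇒ τ)
  𝐝   : Tm Γ (𝕏 ⇒ 𝕏 ⇒ 𝟙)
  𝐛   : Tm Γ 𝟘

-- The redexes of the combinators and recursors.
data _⟶_ {Γ} : Tm Γ τ → Tm Γ τ → Set where
  K-red  : (x : Tm Γ σ) (y : Tm Γ τ) → (K · x · y) ⟶ x
  S-red  : (x : Tm Γ (ρ ⇒ σ ⇒ τ)) (y : Tm Γ (ρ ⇒ σ)) (z : Tm Γ ρ) →
           (S · x · y · z) ⟶ (x · z · (y · z))
  Rec-O  : (y : Tm Γ τ) (z : Tm Γ (τ ⇒ 𝟘 ⇒ τ)) → (Rec · O · y · z) ⟶ y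
  Rec-S  : (n : Tm Γ 𝟘) (y : Tm Γ τ) (z : Tm Γ (τ ⇒ 𝟘 ⇒ τ)) →
           (Rec · (Suc · n) · y · z) ⟶ (z · (Rec · n · y · z) · n)

v0 : Tm (τ ∷ Γ) τ
v0 = var (here refl)

v1 : ∀ {τ₀} → Tm (τ₀ ∷ τ ∷ Γ) τ
v1 = var (there (here refl))

v2 : ∀ {τ₀ τ₁} → Tm (τ₀ ∷ τ₁ ∷ τ ∷ Γ) τ
v2 = var (there (there (here refl)))

v3 : ∀ {τ₀ τ₁ τ₂} → Tm (τ₀ ∷ τ₁ ∷ τ₂ ∷ τ ∷ Γ) τ
v3 = var (there (there (there (here refl))))

v4 : ∀ {τ₀ τ₁ τ₂ τ₃} → Tm (τ₀ ∷ τ₁ ∷ τ₂ ∷ τ₃ ∷ τ ∷ Γ) τ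
v4 = var (there (there (there (there (here refl)))))

v5 : ∀ {τ₀ τ₁ τ₂ τ₃ τ₄} → Tm (τ₀ ∷ τ₁ ∷ τ₂ ∷ τ₃ ∷ τ₄ ∷ τ ∷ Γ) τ
v5 = var (there (there (there (there (there (here refl))))))

Sub : Ctx → Ctx → Set
Sub Γ Δ = ∀ {τ} → τ ∈ Γ → Tm Δ τ

subᵗ : Sub Γ Δ → Tm Γ τ → Tm Δ τ
subᵗ s (var x) = s x
subᵗ s (t · u) = subᵗ s t · subᵗ s u
subᵗ s K       = K
subᵗ s S       = S
subᵗ s O       = O
subᵗ s Suc     = Suc
subᵗ s Rec     = Rec
subᵗ s 𝐝       = 𝐝
subᵗ s 𝐛       = 𝐛

wkₛ : Sub Γ (σ ∷ Γ)
wkₛ x = var (there x)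

wkᵗ : Tm Γ τ → Tm (σ ∷ Γ) τ
wkᵗ = subᵗ wkₛ

lift : Sub Γ Δ → Sub (σ ∷ Γ) (σ ∷ Δ)
lift s (here refl) = v0
lift s (there x)   = wkᵗ (s x)

single : Tm Γ σ → Sub (σ ∷ Γ) Γ
single t (here refl) = t
single t (there x)   = var x

_[_]ᵗ : Tm (σ ∷ Γ) τ → Tm Γ σ → Tm Γ τ
r [ t ]ᵗ = subᵗ (single t) r

closed : Tm [] τ → Tm Γ τ
closed = subᵗ (λ ())

------------------------------------------------------------------------
-- λ-abstraction, defined from the combinators by bracket abstraction.

data Abs (Γ : Ctx) (σ τ : Ty) : Set where
  const : Tm Γ τ → Abs Γ σ τ
  fun   : Tm Γ (σ ⇒ τ) → Abs Γ σ τ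

toFun : Abs Γ σ τ → Tm Γ (σ ⇒ τ)
toFun (const t) = K · t
toFun (fun t)   = t

app : Abs Γ ρ (σ ⇒ τ) → Abs Γ ρ σ → Abs Γ ρ τ
app (const f) (const a) = const (f · a)
app f         a         = fun (S · toFun f · toFun a)

abs : Tm (σ ∷ Γ) τ → Abs Γ σ τ
abs {σ = σ} (var (here refl)) = fun (S · K · K {τ = σ})
abs (var (there x)) = const (var x)
abs (t · u) = app (abs t) (abs u)
abs K       = const K
abs S       = const S
abs O       = const O
abs Suc     = const Suc
abs Rec     = const Rec
abs 𝐝       = const 𝐝
abs 𝐛       = const 𝐛

ƛ : Tm (σ ∷ Γ) τ → Tm Γ (σ ⇒ τ)
ƛ t = toFun (abs t)

------------------------------------------------------------------------
-- Arithmetic.  Each function is a closed term, followed where useful by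
-- the corresponding operation on terms in an arbitrary context.

numeral : ℕ → Tm Γ 𝟘
numeral zero    = O
numeral (suc n) = Suc · numeral n

plus times monus : Tm [] (𝟘 ⇒ 𝟘 ⇒ 𝟘)
pred : Tm [] (𝟘 ⇒ 𝟘)

_+ₒ_ _*ₒ_ _∸ₒ_ maxₒ minₒ : Tm Γ 𝟘 → Tm Γ 𝟘 → Tm Γ 𝟘
m +ₒ n = closed plus · m · n
m *ₒ n = closed times · m · n
m ∸ₒ n = closed monus · m · n
maxₒ m n = m +ₒ (n ∸ₒ m)
minₒ m n = m ∸ₒ (m ∸ₒ n)

plus  = ƛ (ƛ (Rec · v0 · v1 · ƛ (ƛ (Suc · v1))))
times = ƛ (ƛ (Rec · v0 · O · ƛ (ƛ (v1 +ₒ v3))))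
pred  = ƛ (Rec · v0 · O · ƛ (ƛ v0))
monus = ƛ (ƛ (Rec · v0 · v1 · ƛ (ƛ (closed pred · v1))))

pow2 : Tm [] (𝟘 ⇒ 𝟘)
pow2 = ƛ (Rec · v0 · numeral 1 · ƛ (ƛ (v1 +ₒ v1)))

-- quot · n · k is ⌊ n / (k + 1) ⌋.
quot : Tm [] (𝟘 ⇒ 𝟘 ⇒ 𝟘)
quot = ƛ (ƛ (Rec · v1 · O ·
  ƛ (ƛ (v1 +ₒ (numeral 1 ∸ₒ (((Suc · v1) *ₒ (Suc · v2)) ∸ₒ (Suc · v0)))))))

⌊_/suc_⌋ : Tm Γ 𝟘 → Tm Γ 𝟘 → Tm Γ 𝟘
⌊ n /suc k ⌋ = closed quot · n · k

-- f̃ (n) = max { f (k) | k ≤ n }.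
tilde : Tm [] (𝟙 ⇒ 𝟙)
tilde = ƛ (ƛ (Rec · v0 · (v1 · O) · ƛ (ƛ (maxₒ v1 (v3 · (Suc · v0))))))

------------------------------------------------------------------------
-- Reals in signed digit representation.  Integers are coded by naturals:
-- 2z codes z ≥ 0 and 2z - 1 codes -z < 0.  A functional γ of type 1
-- represents the real
--
--     z + Σ_{i ≥ 1} (γᴿ (i) - 1) / 2^i,   z the integer coded by γᴿ (0),
--
-- where γᴿ (0) = γ (0) and γᴿ (i) = min (γ (i) , 2) for i ≥ 1.

rep : Tm [] (𝟙 ⇒ 𝟙)
rep = ƛ (ƛ (Rec · v0 · (v1 · O) ·
  ƛ (ƛ (minₒ (v3 · (Suc · v0)) (numeral 2)))))

_ᴿ : Tm Γ 𝟙 → Tm Γ 𝟙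
γ ᴿ = closed rep · γ

-- The integer coded by c is posPart · c - negPart · c, and code p q is
-- the code of p - q.
parity posPart negPart : Tm [] (𝟘 ⇒ 𝟘)
parity  = ƛ (v0 ∸ₒ numeral 2 *ₒ ⌊ v0 /suc numeral 1 ⌋)
posPart = ƛ ((numeral 1 ∸ₒ closed parity · v0) *ₒ ⌊ v0 /suc numeral 1 ⌋)
negPart = ƛ ((closed parity · v0) *ₒ (Suc · ⌊ v0 /suc numeral 1 ⌋))

code : Tm Γ 𝟘 → Tm Γ 𝟘 → Tm Γ 𝟘
code p q = numeral 2 *ₒ (p ∸ₒ q) +ₒ (numeral 2 *ₒ (q ∸ₒ p) ∸ₒ numeral 1)

-- The integer  P γ n = up γ n - down γ n  is 2^n times the n-th partial
-- sum of the representation:  P γ (n + 1) = 2 (P γ n) + (γᴿ (n + 1) - 1).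
-- If γ represents x then ∣ 2^n x - P γ n ∣ ≤ 1.
upT downT : Tm [] (𝟙 ⇒ 𝟘 ⇒ 𝟘)
upT   = ƛ (ƛ (Rec · v0 · (closed posPart · (v1 ᴿ · O)) ·
          ƛ (ƛ (v1 +ₒ v1 +ₒ v3 ᴿ · (Suc · v0)))))
downT = ƛ (ƛ (Rec · v0 · (closed negPart · (v1 ᴿ · O)) ·
          ƛ (ƛ (Suc · (v1 +ₒ v1)))))

up down : Tm Γ 𝟙 → Tm Γ 𝟘 → Tm Γ 𝟘
up   γ n = closed upT · γ · n
down γ n = closed downT · γ · n

-- Conversely, if A n = p (n) - q (n) is a sequence of integers with
-- ∣ A (n + 1) - 2 (A n) ∣ ≤ 1 for all n, then digits · p · q represents
-- lim A n / 2^n, and its partial sums are exactly A n / 2^n.  All the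
-- operations on reals below are of this form.
digits : Tm [] (𝟙 ⇒ 𝟙 ⇒ 𝟙)
digits = ƛ (ƛ (ƛ (Rec · v0 · code (v2 · O) (v1 · O) ·
  ƛ (ƛ ((v4 · (Suc · v0) +ₒ numeral 2 *ₒ (v3 · v0) +ₒ numeral 1)
        ∸ₒ (numeral 2 *ₒ (v4 · v0) +ₒ v3 · (Suc · v0)))))))

-- A n = m 2^n.
fromNat : Tm [] (𝟘 ⇒ 𝟙)
fromNat = ƛ (closed digits · ƛ (v1 *ₒ closed pow2 · v0) · ƛ O)

natᴿ : Tm Γ 𝟘 → Tm Γ 𝟙
natᴿ m = closed fromNat · m

0ᴿ 1ᴿ : Tm Γ 𝟙
0ᴿ = natᴿ (numeral 0)
1ᴿ = natᴿ (numeral 1)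

-- A n = ⌊ 2^n / (k + 1) ⌋.
recipSuc : Tm [] (𝟘 ⇒ 𝟙)
recipSuc = ƛ (closed digits · ƛ ⌊ closed pow2 · v0 /suc v1 ⌋ · ƛ O)

1/suc_ : Tm Γ 𝟘 → Tm Γ 𝟙
1/suc k = closed recipSuc · k

-- A n = ⌊ (P α (n + 2) + P β (n + 2) + 2) / 4 ⌋; writing the sum of the
-- two partial sums as u - w this is ⌊ (u + 3w + 2) / 4 ⌋ - w.
sumᴿ : Tm [] (𝟙 ⇒ 𝟙 ⇒ 𝟙)
sumᴿ = ƛ (ƛ (closed digits
         · ƛ ⌊ u +ₒ numeral 3 *ₒ w +ₒ numeral 2 /suc numeral 3 ⌋
         · ƛ w))
  where
  u w : Tm (𝟘 ∷ 𝟙 ∷ 𝟙 ∷ []) 𝟘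
  u = up   v2 (Suc · (Suc · v0)) +ₒ up   v1 (Suc · (Suc · v0))
  w = down v2 (Suc · (Suc · v0)) +ₒ down v1 (Suc · (Suc · v0))

_+ᴿ_ : Tm Γ 𝟙 → Tm Γ 𝟙 → Tm Γ 𝟙
α +ᴿ β = closed sumᴿ · α · β

-- A n is the maximum (minimum) of P α n and P β n.
maxᴿ minᴿ : Tm [] (𝟙 ⇒ 𝟙 ⇒ 𝟙)
maxᴿ = ƛ (ƛ (closed digits
         · ƛ (maxₒ (up v2 v0 +ₒ down v1 v0) (up v1 v0 +ₒ down v2 v0))
         · ƛ (down v2 v0 +ₒ down v1 v0)))
minᴿ = ƛ (ƛ (closed digits
         · ƛ (minₒ (up v2 v0 +ₒ down v1 v0) (up v1 v0 +ₒ down v2 v0))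
         · ƛ (down v2 v0 +ₒ down v1 v0)))

-- All values of γ[0,1] are at most 2, so the constant function 2 is a
-- bound l for them that is uniform in γ.
_[0,1] : Tm Γ 𝟙 → Tm Γ 𝟙
γ [0,1] = closed maxᴿ · 0ᴿ · (closed minᴿ · 1ᴿ · γ ᴿ)

------------------------------------------------------------------------
-- Formulas.

data Form (Γ : Ctx) : Set where
  _≈_           : Tm Γ 𝟘 → Tm Γ 𝟘 → Form Γ
  ⊥̇             : Form Γ
  _∧̇_ _∨̇_ _⊃_   : Form Γ → Form Γ → Form Γ
  ∀̇ ∃̇           : (τ : Ty) → Form (τ ∷ Γ) → Form Γ

sub : Sub Γ Δ → Form Γ → Form Δ
sub s (t ≈ u)  = subᵗ s t ≈ subᵗ s u
sub s ⊥̇        = ⊥̇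
sub s (A ∧̇ B)  = sub s A ∧̇ sub s B
sub s (A ∨̇ B)  = sub s A ∨̇ sub s B
sub s (A ⊃ B)  = sub s A ⊃ sub s B
sub s (∀̇ τ A)  = ∀̇ τ (sub (lift s) A)
sub s (∃̇ τ A)  = ∃̇ τ (sub (lift s) A)

wk : Form Γ → Form (σ ∷ Γ)
wk = sub wkₛ

_[_] : Form (σ ∷ Γ) → Tm Γ σ → Form Γ
A [ t ] = sub (single t) A

-- A(x) ↦ A(t(x)).
_[↦_] : Form (σ ∷ Γ) → Tm (ρ ∷ Γ) σ → Form (ρ ∷ Γ)
_[↦_] {σ} {Γ} {ρ} A t = sub s A
  where
  s : Sub (σ ∷ Γ) (ρ ∷ Γ)
  s (here refl) = t
  s (there x)   = var (there x)

-- Weakening by a fresh variable in third position.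
wk₂ : Form (σ ∷ τ ∷ Γ) → Form (σ ∷ τ ∷ ρ ∷ Γ)
wk₂ = sub (lift (lift wkₛ))

_≤₀_ _<₀_ : Tm Γ 𝟘 → Tm Γ 𝟘 → Form Γ
m ≤₀ n = m ∸ₒ n ≈ O
m <₀ n = Suc · m ≤₀ n

∀≤ ∃≤ : Tm Γ 𝟘 → Form (𝟘 ∷ Γ) → Form Γ
∀≤ n A = ∀̇ 𝟘 (v0 ≤₀ wkᵗ n ⊃ A)
∃≤ n A = ∃̇ 𝟘 (v0 ≤₀ wkᵗ n ∧̇ A)

∀[0,1] ∃[0,1] : Form (𝟙 ∷ Γ) → Form Γ
∀[0,1] A = ∀̇ 𝟙 (A [↦ v0 [0,1] ])
∃[0,1] A = ∃̇ 𝟙 (A [↦ v0 [0,1] ])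

-- α ≤ β iff P α n ≤ P β n + 2 for all n, since both partial sums are
-- within 1 of the scaled reals; < is the classical negation of ≥.
leAt ltAt : Tm Γ 𝟙 → Tm Γ 𝟙 → Form (𝟘 ∷ Γ)
leAt α β =
  up (wkᵗ α) v0 +ₒ down (wkᵗ β) v0
    ≤₀ up (wkᵗ β) v0 +ₒ down (wkᵗ α) v0 +ₒ numeral 2
ltAt α β =
  up (wkᵗ α) v0 +ₒ down (wkᵗ β) v0 +ₒ numeral 2
    <₀ up (wkᵗ β) v0 +ₒ down (wkᵗ α) v0

_≤ᴿ_ _<ᴿ_ _=ᴿ_ : Tm Γ 𝟙 → Tm Γ 𝟙 → Form Γ
α ≤ᴿ β = ∀̇ 𝟘 (leAt α β)
α <ᴿ β = ∃̇ 𝟘 (ltAt α β)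
α =ᴿ β = ∀̇ 𝟘 (leAt α β ∧̇ leAt β α)

_=ˣ_ : Tm Γ 𝕏 → Tm Γ 𝕏 → Form Γ
x =ˣ y = 𝐝 · x · y =ᴿ 0ᴿ

-- Equality at an arbitrary type, pointwise at function types.
_≐_ : Tm Γ τ → Tm Γ τ → Form Γ
_≐_ {τ = 𝟘}     s t = s ≈ t
_≐_ {τ = 𝕏}     s t = s =ˣ t
_≐_ {τ = σ ⇒ τ} s t = ∀̇ σ (wkᵗ s · v0 ≐ wkᵗ t · v0)

_∈Fix_ : Tm Γ 𝕏 → Tm Γ (𝕏 ⇒ 𝕏) → Form Γ
x ∈Fix U = U · x =ˣ x

data QF {Γ} : Form Γ → Set where
  eq    : (s t : Tm Γ 𝟘) → QF (s ≈ t)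
  bot   : QF ⊥̇
  conj  : ∀ {A B} → QF A → QF B → QF (A ∧̇ B)
  disj  : ∀ {A B} → QF A → QF B → QF (A ∨̇ B)
  imp   : ∀ {A B} → QF A → QF B → QF (A ⊃ B)

data Bounded : ∀ {Γ} → Form Γ → Set where
  eq     : (s t : Tm Γ 𝟘) → Bounded (s ≈ t)
  bot    : Bounded {Γ} ⊥̇
  conj   : {A B : Form Γ} → Bounded A → Bounded B → Bounded (A ∧̇ B)
  disj   : {A B : Form Γ} → Bounded A → Bounded B → Bounded (A ∨̇ B)
  imp    : {A B : Form Γ} → Bounded A → Bounded B → Bounded (A ⊃ B)
  all≤   : {A : Form (𝟘 ∷ Γ)} (n : Tm Γ 𝟘) → Bounded A → Bounded (∀≤ n A)
  ex≤    : {A : Form (𝟘 ∷ Γ)} (n : Tm Γ 𝟘) → Bounded A → Bounded (∃≤ n A)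
  allX   : {A : Form (𝕏 ∷ Γ)} → Bounded A → Bounded (∀̇ 𝕏 A)
  exX    : {A : Form (𝕏 ∷ Γ)} → Bounded A → Bounded (∃̇ 𝕏 A)
  all01  : {A : Form (𝟙 ∷ Γ)} → Bounded A → Bounded (∀[0,1] A)
  ex01   : {A : Form (𝟙 ∷ Γ)} → Bounded A → Bounded (∃[0,1] A)

data IsΣ {Γ} : Form Γ → Set where
  isΣ : {B : Form (𝟘 ∷ Γ)} → Bounded B → IsΣ (∃̇ 𝟘 B)

------------------------------------------------------------------------
-- Theories and derivations.

Theory : Set₁
Theory = ∀ {Γ} → Form Γ → Set

-- Natural deduction for classical many-sorted logic over the axioms T.
-- `nonempty` is needed because contexts record the free variables
-- explicitly: without it a sort having no closed term, such as 𝕏, could be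
-- empty.  The premise of the quantifier-free extensionality rule `ext` must
-- be proved outright, i.e. from no hypotheses.
module Deduction (T : Theory) where

  infix 1 _∣_⊢_

  data _∣_⊢_ : (Γ : Ctx) → List (Form Γ) → Form Γ → Set where
    axiom : ∀ {H} {A : Form Γ} → T A → Γ ∣ H ⊢ A
    hyp   : ∀ {H} {A : Form Γ} → A ∈ H → Γ ∣ H ⊢ A
    ∧I    : ∀ {H} {A B : Form Γ} → Γ ∣ H ⊢ A → Γ ∣ H ⊢ B → Γ ∣ H ⊢ A ∧̇ B
    ∧E₁   : ∀ {H} {A B : Form Γ} → Γ ∣ H ⊢ A ∧̇ B → Γ ∣ H ⊢ A
    ∧E₂   : ∀ {H} {A B : Form Γ} → Γ ∣ H ⊢ A ∧̇ B → Γ ∣ H ⊢ B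
    ∨I₁   : ∀ {H} {A B : Form Γ} → Γ ∣ H ⊢ A → Γ ∣ H ⊢ A ∨̇ B
    ∨I₂   : ∀ {H} {A B : Form Γ} → Γ ∣ H ⊢ B → Γ ∣ H ⊢ A ∨̇ B
    ∨E    : ∀ {H} {A B C : Form Γ} →
            Γ ∣ H ⊢ A ∨̇ B → Γ ∣ A ∷ H ⊢ C → Γ ∣ B ∷ H ⊢ C → Γ ∣ H ⊢ C
    ⊃I    : ∀ {H} {A B : Form Γ} → Γ ∣ A ∷ H ⊢ B → Γ ∣ H ⊢ A ⊃ B
    ⊃E    : ∀ {H} {A B : Form Γ} → Γ ∣ H ⊢ A ⊃ B → Γ ∣ H ⊢ A → Γ ∣ H ⊢ B
    raa   : ∀ {H} {A : Form Γ} → Γ ∣ (A ⊃ ⊥̇) ∷ H ⊢ ⊥̇ → Γ ∣ H ⊢ A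
    ∀I    : ∀ {H} {A : Form (τ ∷ Γ)} →
            τ ∷ Γ ∣ map wk H ⊢ A → Γ ∣ H ⊢ ∀̇ τ A
    ∀E    : ∀ {H} {A : Form (τ ∷ Γ)} →
            Γ ∣ H ⊢ ∀̇ τ A → (t : Tm Γ τ) → Γ ∣ H ⊢ A [ t ]
    ∃I    : ∀ {H} {A : Form (τ ∷ Γ)} →
            (t : Tm Γ τ) → Γ ∣ H ⊢ A [ t ] → Γ ∣ H ⊢ ∃̇ τ A
    ∃E    : ∀ {H} {A : Form (τ ∷ Γ)} {C : Form Γ} →
            Γ ∣ H ⊢ ∃̇ τ A → τ ∷ Γ ∣ A ∷ map wk H ⊢ wk C → Γ ∣ H ⊢ C
    nonempty : ∀ {H} (τ : Ty) → Γ ∣ H ⊢ ∃̇ τ (O ≈ O)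
    ext   : ∀ {H} {A : Form Γ} → QF A →
            (s t : Tm Γ σ) (r : Tm (σ ∷ Γ) τ) →
            Γ ∣ [] ⊢ A ⊃ s ≐ t →
            Γ ∣ H ⊢ A ⊃ r [ s ]ᵗ ≐ r [ t ]ᵗ

_⊢_ : Theory → Form [] → Set
T ⊢ A = [] ∣ [] ⊢′ A
  where open Deduction T renaming (_∣_⊢_ to _∣_⊢′_)

data 𝒯ᴹ : Theory where
  ≈-refl    : (t : Tm Γ 𝟘) → 𝒯ᴹ (t ≈ t)
  ≈-subst   : (A : Form (𝟘 ∷ Γ)) (s t : Tm Γ 𝟘) →
              𝒯ᴹ (s ≈ t ⊃ A [ s ] ⊃ A [ t ])
  -- The only primitive equality is at type 𝟘, so a redex of any type is
  -- contracted inside a term r of type 𝟘.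
  conv      : {s t : Tm Γ τ} → s ⟶ t → (r : Tm (τ ∷ Γ) 𝟘) →
              𝒯ᴹ (r [ s ]ᵗ ≈ r [ t ]ᵗ)
  Suc≢O     : (t : Tm Γ 𝟘) → 𝒯ᴹ (Suc · t ≈ O ⊃ ⊥̇)
  Suc-inj   : (s t : Tm Γ 𝟘) → 𝒯ᴹ (Suc · s ≈ Suc · t ⊃ s ≈ t)
  induction : (A : Form (𝟘 ∷ Γ)) →
              𝒯ᴹ (A [ O ] ⊃ ∀̇ 𝟘 (A ⊃ A [↦ Suc · v0 ]) ⊃ ∀̇ 𝟘 A)
  d-rep     : 𝒯ᴹ {Γ} (∀̇ 𝕏 (∀̇ 𝕏 (∀̇ 𝟘 (𝐝 · v2 · v1 · v0 ≈ (𝐝 · v2 · v1) ᴿ · v0))))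
  d-refl    : 𝒯ᴹ {Γ} (∀̇ 𝕏 (𝐝 · v0 · v0 =ᴿ 0ᴿ))
  d-sym     : 𝒯ᴹ {Γ} (∀̇ 𝕏 (∀̇ 𝕏 (𝐝 · v1 · v0 =ᴿ 𝐝 · v0 · v1)))
  d-tri     : 𝒯ᴹ {Γ} (∀̇ 𝕏 (∀̇ 𝕏 (∀̇ 𝕏
                (𝐝 · v2 · v0 ≤ᴿ 𝐝 · v2 · v1 +ᴿ 𝐝 · v1 · v0))))
  d-bound   : 𝒯ᴹ {Γ} (∀̇ 𝕏 (∀̇ 𝕏 (𝐝 · v1 · v0 ≤ᴿ natᴿ 𝐛)))

data 𝒯ᴹ⁺ : Theory where
  base   : {A : Form Γ} → 𝒯ᴹ A → 𝒯ᴹ⁺ A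
  choice : (A : Form (𝟘 ∷ 𝟘 ∷ Γ)) → IsΣ A →
           𝒯ᴹ⁺ (∀̇ 𝟘 (∃̇ 𝟘 A) ⊃ ∃̇ 𝟙 (∀̇ 𝟘 (∃≤ (closed tilde · v1 · v0) (wk₂ A))))
  coll₀  : (A : Form (𝟘 ∷ 𝟘 ∷ Γ)) → IsΣ A → (m : Tm Γ 𝟘) →
           𝒯ᴹ⁺ (∀≤ m (∃̇ 𝟘 A) ⊃ ∃̇ 𝟘 (∀≤ (wkᵗ m) (∃≤ v1 (wk₂ A))))
  coll₁  : (A : Form (𝟘 ∷ 𝟙 ∷ Γ)) → IsΣ A →
           𝒯ᴹ⁺ (∀[0,1] (∃̇ 𝟘 A) ⊃ ∃̇ 𝟘 (∀[0,1] (∃≤ v1 (wk₂ A))))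
  collX  : (A : Form (𝟘 ∷ 𝕏 ∷ Γ)) → IsΣ A →
           𝒯ᴹ⁺ (∀̇ 𝕏 (∃̇ 𝟘 A) ⊃ ∃̇ 𝟘 (∀̇ 𝕏 (∃≤ v1 (wk₂ A))))

{-# OPTIONS --safe #-}
module Submission where

open import Algebra.Bundles using (CommutativeSemiring; RawRing)
open import Algebra.Solver.Ring.AlmostCommutativeRing
  using (_-Raw-AlmostCommutative⟶_; fromCommutativeSemiring)
open import Algebra.Structures.Biased
  using (isCommutativeSemiringˡ; isCommutativeMonoidˡ)
open import Data.List using (List; []; _∷_; map)
open import Data.List.Membership.Propositional using (_∈_)
open import Data.List.Relation.Binary.Subset.Propositional using (_⊆_)
open import Data.List.Relation.Binary.Subset.Propositional.Properties
  using (map⁺; ∷⁺ʳ)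
open import Data.List.Relation.Unary.Any using (here; there)
open import Data.Maybe as Maybe using (Maybe)
open import Data.Nat as ℕ using (ℕ; zero; suc)
open import Data.Product using (∃; _,_; proj₁; proj₂)
open import Level using (0ℓ)
open import Relation.Binary.Consequences using (dec⇒weaklyDec)
open import Relation.Binary.PropositionalEquality
  using (_≡_; refl; sym; trans; cong; cong₂; subst; subst₂)
open import Relation.Binary.Structures using (IsEquivalence)
open import Defs
open Deduction 𝒯ᴹ⁺

-- By classical logic the hypothesis says that every y has an n such that,
-- if the n-th approximation of d (U (y) , y) is compatible with 0, then the
-- n-th approximations witness λ < θ (y) + 1/(k+1).  Bounded collection over X
-- makes n ≤ N uniform in y.  If d (U (u m) , u m) ≤ 1/(2^N + 1), then its
-- approximations up to N are compatible with 0, and the claim follows for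
-- y = u m.  The rest is elementary arithmetic of the signed digit
-- representation inside the theory, including a proof of d (x , y) ≥ 0.

-- The index that witnesses the conclusion at u m depends on m, whereas the precision demanded of d
-- (U (u m) , u m) has to be fixed before m is known; this is the dependence that the bound N
-- removes. The collected statement speaks of every point of X, so it applies to u m itself and not
-- to some nearby fixed point, which need not exist. The number 2^N + 1 comes from the
-- representation: the partial sums of 1/(r+1) are given by ⌊2^n/(r+1)⌋, which vanishes as long as
-- 2^n ≤ r. Up to precision N, comparing with 1/(2^N + 1) is therefore the same as comparing with 0.
-- Equality with 0 is two-sided and nonnegativity of d is not an axiom. It has to be extracted from
-- d (x , x) ≤ d (x , y) + d (y , x) at each single precision and with the exact tolerance 2 of
-- `≤ᴿ`, although every comparison used on the way loses some units; the loss is absorbed by looking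
-- three digits further.

private
  variable
    Γ Δ Ε : Ctx
    ρ σ τ : Ty
    H H′ : List (Form Γ)
    A B C D : Form Γ
    a a′ b b′ c c′ d e k m n : Tm Γ 𝟘

-- Substitution and weakening

subᵗ-∘ : {s : Sub Γ Δ} {s′ : Sub Δ Ε} {r : Sub Γ Ε} →
         (∀ {τ} (x : τ ∈ Γ) → subᵗ s′ (s x) ≡ r x) →
         (t : Tm Γ τ) → subᵗ s′ (subᵗ s t) ≡ subᵗ r t
subᵗ-∘ e (var x) = e x
subᵗ-∘ e (t · u) = cong₂ _·_ (subᵗ-∘ e t) (subᵗ-∘ e u)
subᵗ-∘ e K       = refl
subᵗ-∘ e S       = refl
subᵗ-∘ e O       = refl
subᵗ-∘ e Suc     = refl
subᵗ-∘ e Rec     = refl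
subᵗ-∘ e 𝐝       = refl
subᵗ-∘ e 𝐛       = refl

subᵗ-id : {s : Sub Γ Γ} → (∀ {τ} (x : τ ∈ Γ) → s x ≡ var x) →
          (t : Tm Γ τ) → subᵗ s t ≡ t
subᵗ-id e (var x) = e x
subᵗ-id e (t · u) = cong₂ _·_ (subᵗ-id e t) (subᵗ-id e u)
subᵗ-id e K       = refl
subᵗ-id e S       = refl
subᵗ-id e O       = refl
subᵗ-id e Suc     = refl
subᵗ-id e Rec     = refl
subᵗ-id e 𝐝       = refl
subᵗ-id e 𝐛       = refl

wkᵗ-single : (a : Tm Γ σ) (t : Tm Γ τ) → wkᵗ t [ a ]ᵗ ≡ t
wkᵗ-single a t =
  trans (subᵗ-∘ {r = var} (λ _ → refl) t) (subᵗ-id (λ _ → refl) t)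

lift-∘ : {s : Sub Γ Δ} {s′ : Sub Δ Ε} {r : Sub Γ Ε} →
         (∀ {τ} (x : τ ∈ Γ) → subᵗ s′ (s x) ≡ r x) →
         (x : τ ∈ σ ∷ Γ) → subᵗ (lift s′) (lift s x) ≡ lift r x
lift-∘ e (here refl) = refl
lift-∘ {s = s} {s′ = s′} e (there x) =
  trans (subᵗ-∘ (λ _ → refl) (s x))
    (trans (sym (subᵗ-∘ (λ _ → refl) (s x))) (cong wkᵗ (e x)))

sub-∘ : {s : Sub Γ Δ} {s′ : Sub Δ Ε} {r : Sub Γ Ε} →
        (∀ {τ} (x : τ ∈ Γ) → subᵗ s′ (s x) ≡ r x) →
        (A : Form Γ) → sub s′ (sub s A) ≡ sub r A
sub-∘ e (t ≈ u)  = cong₂ _≈_ (subᵗ-∘ e t) (subᵗ-∘ e u)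
sub-∘ e ⊥̇        = refl
sub-∘ e (A ∧̇ B)  = cong₂ _∧̇_ (sub-∘ e A) (sub-∘ e B)
sub-∘ e (A ∨̇ B)  = cong₂ _∨̇_ (sub-∘ e A) (sub-∘ e B)
sub-∘ e (A ⊃ B)  = cong₂ _⊃_ (sub-∘ e A) (sub-∘ e B)
sub-∘ e (∀̇ τ A)  = cong (∀̇ τ) (sub-∘ (lift-∘ e) A)
sub-∘ e (∃̇ τ A)  = cong (∃̇ τ) (sub-∘ (lift-∘ e) A)

infixr 5 _∷ₛ_

_∷ₛ_ : Tm Δ σ → Sub Γ Δ → Sub (σ ∷ Γ) Δ
(t ∷ₛ s) (here refl) = t
(t ∷ₛ s) (there x)   = s x

sub-lift : (t : Tm Δ σ) (s : Sub Γ Δ) (A : Form (σ ∷ Γ)) →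
           sub (lift s) A [ t ] ≡ sub (t ∷ₛ s) A
sub-lift t s = sub-∘ λ where
  (here refl) → refl
  (there x)   → wkᵗ-single t (s x)

-- Two successive uses of `∀E` leave `wkᵗ a [ b ]ᵗ` behind, which equals `a` only propositionally.
-- One simultaneous substitution reduces by itself once `A` is concrete.
∀E₂ : {A : Form (τ ∷ σ ∷ Γ)} → Γ ∣ H ⊢ ∀̇ σ (∀̇ τ A) →
      (a : Tm Γ σ) (b : Tm Γ τ) → Γ ∣ H ⊢ sub (b ∷ₛ single a) A
∀E₂ {A = A} p a b =
  subst (_ ∣ _ ⊢_) (sub-lift b (single a) A) (∀E (∀E p a) b)

∀E₃ : {A : Form (ρ ∷ τ ∷ σ ∷ Γ)} → Γ ∣ H ⊢ ∀̇ σ (∀̇ τ (∀̇ ρ A)) →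
      (a : Tm Γ σ) (b : Tm Γ τ) (c : Tm Γ ρ) →
      Γ ∣ H ⊢ sub (c ∷ₛ b ∷ₛ single a) A
∀E₃ {A = A} p a b c =
  subst (_ ∣ _ ⊢_) (sub-lift c (b ∷ₛ single a) A) (∀E (∀E₂ p a b) c)

weaken : H ⊆ H′ → Γ ∣ H ⊢ A → Γ ∣ H′ ⊢ A
weaken i (axiom x)      = axiom x
weaken i (hyp x)        = hyp (i x)
weaken i (∧I p q)       = ∧I (weaken i p) (weaken i q)
weaken i (∧E₁ p)        = ∧E₁ (weaken i p)
weaken i (∧E₂ p)        = ∧E₂ (weaken i p)
weaken i (∨I₁ p)        = ∨I₁ (weaken i p)
weaken i (∨I₂ p)        = ∨I₂ (weaken i p)
weaken i (∨E p q r)     =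
  ∨E (weaken i p) (weaken (∷⁺ʳ _ i) q) (weaken (∷⁺ʳ _ i) r)
weaken i (⊃I p)         = ⊃I (weaken (∷⁺ʳ _ i) p)
weaken i (⊃E p q)       = ⊃E (weaken i p) (weaken i q)
weaken i (raa p)        = raa (weaken (∷⁺ʳ _ i) p)
weaken i (∀I p)         = ∀I (weaken (map⁺ wk i) p)
weaken i (∀E p t)       = ∀E (weaken i p) t
weaken i (∃I t p)       = ∃I t (weaken i p)
weaken i (∃E p q)       = ∃E (weaken i p) (weaken (∷⁺ʳ _ (map⁺ wk i)) q)
weaken i (nonempty τ)   = nonempty τ
weaken i (ext q s t r p) = ext q s t r p

-- Derived rules of logic and equality

hyp₀ : Γ ∣ A ∷ H ⊢ A
hyp₀ = hyp (here refl)

hyp₁ : Γ ∣ A ∷ B ∷ H ⊢ B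
hyp₁ = weaken there hyp₀

hyp₂ : Γ ∣ A ∷ B ∷ C ∷ H ⊢ C
hyp₂ = weaken there hyp₁

hyp₃ : Γ ∣ A ∷ B ∷ C ∷ D ∷ H ⊢ D
hyp₃ = weaken there hyp₂

⊥E : Γ ∣ H ⊢ ⊥̇ → Γ ∣ H ⊢ A
⊥E p = raa (weaken there p)

≈-refl′ : {t : Tm Γ 𝟘} → Γ ∣ H ⊢ t ≈ t
≈-refl′ = axiom (base (≈-refl _))

≈-cong : (r : Tm (𝟘 ∷ Γ) 𝟘) → Γ ∣ H ⊢ a ≈ b → Γ ∣ H ⊢ r [ a ]ᵗ ≈ r [ b ]ᵗ
≈-cong {Γ} {H} {a} {b} r p =
  subst (λ t → Γ ∣ H ⊢ t ≈ r [ b ]ᵗ) (wkᵗ-single b (r [ a ]ᵗ))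
    (⊃E (⊃E (axiom (base (≈-subst (wkᵗ (r [ a ]ᵗ) ≈ r) a b))) p)
      (subst (λ t → Γ ∣ H ⊢ t ≈ r [ a ]ᵗ) (sym (wkᵗ-single a (r [ a ]ᵗ)))
        ≈-refl′))

≈-sym : Γ ∣ H ⊢ a ≈ b → Γ ∣ H ⊢ b ≈ a
≈-sym {a = a} {b = b} p =
  subst (λ t → _ ∣ _ ⊢ b ≈ t) (wkᵗ-single b a)
    (⊃E (⊃E (axiom (base (≈-subst (v0 ≈ wkᵗ a) a b))) p)
      (subst (λ t → _ ∣ _ ⊢ a ≈ t) (sym (wkᵗ-single a a)) ≈-refl′))

≈-trans : Γ ∣ H ⊢ a ≈ b → Γ ∣ H ⊢ b ≈ c → Γ ∣ H ⊢ a ≈ c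
≈-trans {a = a} {b = b} {c = c} p q =
  subst (λ t → _ ∣ _ ⊢ t ≈ c) (wkᵗ-single c a)
    (⊃E (⊃E (axiom (base (≈-subst (wkᵗ a ≈ v0) b c))) q)
      (subst (λ t → _ ∣ _ ⊢ t ≈ b) (sym (wkᵗ-single b a)) p))

·-cong : (f : Tm Γ (𝟘 ⇒ 𝟘)) → Γ ∣ H ⊢ a ≈ b → Γ ∣ H ⊢ f · a ≈ f · b
·-cong {Γ} {H} {a} {b} f p =
  subst₂ (λ g h → Γ ∣ H ⊢ g · a ≈ h · b) (wkᵗ-single a f) (wkᵗ-single b f)
    (≈-cong (wkᵗ f · v0) p)

·-cong₂ : (f : Tm Γ (𝟘 ⇒ 𝟘 ⇒ 𝟘)) → Γ ∣ H ⊢ a ≈ a′ → Γ ∣ H ⊢ b ≈ b′ →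
          Γ ∣ H ⊢ f · a · b ≈ f · a′ · b′
·-cong₂ {Γ} {H} {a} {a′} {b} f p q =
  ≈-trans
    (subst₂ (λ t u → Γ ∣ H ⊢ t ≈ u)
      (cong₂ (λ g u → g · a · u) (wkᵗ-single a f) (wkᵗ-single a b))
      (cong₂ (λ g u → g · a′ · u) (wkᵗ-single a′ f) (wkᵗ-single a′ b))
      (≈-cong (wkᵗ f · v0 · wkᵗ b) p))
    (·-cong (f · a′) q)

-- Conversion of terms of arbitrary type

infix 4 _∼_

-- Equality is primitive at type 𝟘 only, so convertibility at type τ is taken to be
-- interchangeability in every term of type 𝟘 with a hole of type τ. Congruence then amounts to
-- composing contexts.
_∼_ : Tm Γ τ → Tm Γ τ → Set
_∼_ {Γ} {τ} s t = ∀ H (r : Tm (τ ∷ Γ) 𝟘) → Γ ∣ H ⊢ r [ s ]ᵗ ≈ r [ t ]ᵗ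

∼-refl : {t : Tm Γ τ} → t ∼ t
∼-refl H r = ≈-refl′

∼-trans : {s t u : Tm Γ τ} → s ∼ t → t ∼ u → s ∼ u
∼-trans p q H r = ≈-trans (p H r) (q H r)

⟶⇒∼ : {s t : Tm Γ τ} → s ⟶ t → s ∼ t
⟶⇒∼ p H r = axiom (base (conv p r))

∼⇒≈ : a ∼ b → Γ ∣ H ⊢ a ≈ b
∼⇒≈ p = p _ v0

∼-cong : (c : Tm (σ ∷ Γ) τ) {s t : Tm Γ σ} → s ∼ t → c [ s ]ᵗ ∼ c [ t ]ᵗ
∼-cong {Γ = Γ} c {s} {t} p H r =
  subst₂ (λ f g → Γ ∣ H ⊢ f ≈ g) (hole s) (hole t) (p H (subᵗ (c ∷ₛ wkₛ) r))
  where
  hole : ∀ u → subᵗ (c ∷ₛ wkₛ) r [ u ]ᵗ ≡ r [ c [ u ]ᵗ ]ᵗ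
  hole u = subᵗ-∘ (λ { (here refl) → refl ; (there x) → refl }) r

·-∼ : {s s′ : Tm Γ (σ ⇒ τ)} {t t′ : Tm Γ σ} → s ∼ s′ → t ∼ t′ → s · t ∼ s′ · t′
·-∼ {s = s} {s′} {t} {t′} p q = ∼-trans
  (subst₂ (λ f g → s · f ∼ s′ · g) (wkᵗ-single s t) (wkᵗ-single s′ t)
    (∼-cong (v0 · wkᵗ t) p))
  (subst₂ (λ f g → f · t ∼ g · t′) (wkᵗ-single t s′) (wkᵗ-single t′ s′)
    (∼-cong (wkᵗ s′ · v0) q))

Reduct : Tm Γ τ → Set
Reduct t = ∃ λ u → t ∼ u

-- The number bounds the depth of contraction.
apply : ℕ → (f : Tm Γ (σ ⇒ τ)) (a : Tm Γ σ) → Reduct (f · a)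
apply zero    f a = f · a , ∼-refl
apply (suc k) (K · x) a = x , ⟶⇒∼ (K-red x a)
apply (suc k) (S · x · y) a =
  let f , p = apply k x a
      b , q = apply k y a
      t , r = apply k f b
  in t , ∼-trans (⟶⇒∼ (S-red x y a)) (∼-trans (·-∼ p q) r)
apply (suc k) (Rec · O · y) z = y , ⟶⇒∼ (Rec-O y z)
apply (suc k) (Rec · (Suc · n) · y) z =
  let t , p = apply k (Rec · n · y) z
      f , q = apply k z t
      u , r = apply k f n
  in u , ∼-trans (⟶⇒∼ (Rec-S n y z))
           (∼-trans (·-∼ (∼-trans (·-∼ ∼-refl p) q) ∼-refl) r)
apply (suc k) f a = f · a , ∼-refl

norm : ℕ → (t : Tm Γ τ) → Reduct t
norm k (f · a) =
  let g , p = norm k f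
      b , q = norm k a
      t , r = apply k g b
  in t , ∼-trans (·-∼ p q) r
norm k t = t , ∼-refl

-- Any fuel is sound, since `norm` returns a conversion with its result; 500 only has to bring both
-- sides to the same term. On an unknown Agda term `norm` is stuck, so the equations below are
-- proved for object variables and then instantiated by `∀E`.
compute : {a b : Tm Γ 𝟘} →
          proj₁ (norm 500 a) ≡ proj₁ (norm 500 b) → Γ ∣ H ⊢ a ≈ b
compute {Γ = Γ} {H = H} {a = a} {b = b} e =
  ≈-trans (∼⇒≈ (proj₂ (norm 500 a)))
    (subst (λ t → Γ ∣ H ⊢ t ≈ b) (sym e) (≈-sym (∼⇒≈ (proj₂ (norm 500 b)))))

-- Correctness of bracket abstraction

private
  ⟦_⟧_ : Abs Γ σ τ → Tm Γ σ → Tm Γ τ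
  ⟦ const t ⟧ a = t
  ⟦ fun t ⟧   a = t · a

  toFun-∼ : (x : Abs Γ σ τ) (a : Tm Γ σ) → toFun x · a ∼ ⟦ x ⟧ a
  toFun-∼ (const t) a = ⟶⇒∼ (K-red t a)
  toFun-∼ (fun t)   a = ∼-refl

  app-S : (x : Abs Γ ρ (σ ⇒ τ)) (y : Abs Γ ρ σ) (a : Tm Γ ρ) →
          S · toFun x · toFun y · a ∼ (⟦ x ⟧ a) · (⟦ y ⟧ a)
  app-S x y a = ∼-trans (⟶⇒∼ (S-red _ _ a)) (·-∼ (toFun-∼ x a) (toFun-∼ y a))

  app-∼ : (x : Abs Γ ρ (σ ⇒ τ)) (y : Abs Γ ρ σ) (a : Tm Γ ρ) →
          ⟦ app x y ⟧ a ∼ (⟦ x ⟧ a) · (⟦ y ⟧ a)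
  app-∼ (const f) (const b)   a = ∼-refl
  app-∼ (const f) y@(fun _)   a = app-S (const f) y a
  app-∼ x@(fun _) y           a = app-S x y a

  abs-∼ : (t : Tm (σ ∷ Γ) τ) (a : Tm Γ σ) → ⟦ abs t ⟧ a ∼ t [ a ]ᵗ
  abs-∼ (var (here refl)) a =
    ∼-trans (⟶⇒∼ (S-red _ _ a)) (⟶⇒∼ (K-red a _))
  abs-∼ (var (there x)) a = ∼-refl
  abs-∼ (t · u) a =
    ∼-trans (app-∼ (abs t) (abs u) a) (·-∼ (abs-∼ t a) (abs-∼ u a))
  abs-∼ K   a = ∼-refl
  abs-∼ S   a = ∼-refl
  abs-∼ O   a = ∼-refl
  abs-∼ Suc a = ∼-refl
  abs-∼ Rec a = ∼-refl
  abs-∼ 𝐝   a = ∼-refl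
  abs-∼ 𝐛   a = ∼-refl

-- `norm` would unfold the body too; this removes a single abstraction and keeps the body in the
-- form in which other lemmas speak of it.
β : (t : Tm (σ ∷ Γ) τ) (a : Tm Γ σ) → ƛ t · a ∼ t [ a ]ᵗ
β t a = ∼-trans (toFun-∼ (abs t) a) (abs-∼ t a)

-- Arithmetic

infixr 2 _≈⟨_⟩_
infix  3 _∎

_≈⟨_⟩_ : (a : Tm Γ 𝟘) → Γ ∣ H ⊢ a ≈ b → Γ ∣ H ⊢ b ≈ c → Γ ∣ H ⊢ a ≈ c
a ≈⟨ p ⟩ q = ≈-trans p q

_∎ : (a : Tm Γ 𝟘) → Γ ∣ H ⊢ a ≈ a
a ∎ = ≈-refl′

ind : {A : Form (𝟘 ∷ Γ)} → Γ ∣ H ⊢ A [ O ] →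
      𝟘 ∷ Γ ∣ A ∷ map wk H ⊢ A [↦ Suc · v0 ] → Γ ∣ H ⊢ ∀̇ 𝟘 A
ind p q = ⊃E (⊃E (axiom (base (induction _))) p) (∀I (⊃I q))

+-cong : Γ ∣ H ⊢ a ≈ a′ → Γ ∣ H ⊢ b ≈ b′ → Γ ∣ H ⊢ a +ₒ b ≈ a′ +ₒ b′
+-cong = ·-cong₂ (closed plus)

*-cong : Γ ∣ H ⊢ a ≈ a′ → Γ ∣ H ⊢ b ≈ b′ → Γ ∣ H ⊢ a *ₒ b ≈ a′ *ₒ b′
*-cong = ·-cong₂ (closed times)

∸-cong : Γ ∣ H ⊢ a ≈ a′ → Γ ∣ H ⊢ b ≈ b′ → Γ ∣ H ⊢ a ∸ₒ b ≈ a′ ∸ₒ b′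
∸-cong = ·-cong₂ (closed monus)

Suc-cong : Γ ∣ H ⊢ a ≈ b → Γ ∣ H ⊢ Suc · a ≈ Suc · b
Suc-cong = ·-cong Suc

pred-cong : Γ ∣ H ⊢ a ≈ b → Γ ∣ H ⊢ closed pred · a ≈ closed pred · b
pred-cong = ·-cong (closed pred)

+-identityʳ : (a : Tm Γ 𝟘) → Γ ∣ H ⊢ a +ₒ O ≈ a
+-identityʳ = ∀E {A = v0 +ₒ O ≈ v0} (∀I (compute refl))

+-Suc : (a b : Tm Γ 𝟘) → Γ ∣ H ⊢ a +ₒ Suc · b ≈ Suc · (a +ₒ b)
+-Suc = ∀E₂ {A = v1 +ₒ Suc · v0 ≈ Suc · (v1 +ₒ v0)} (∀I (∀I (compute refl)))

+-identityˡ : (a : Tm Γ 𝟘) → Γ ∣ H ⊢ O +ₒ a ≈ a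
+-identityˡ = ∀E {A = O +ₒ v0 ≈ v0} (ind
  (+-identityʳ _)
  (≈-trans (+-Suc _ _) (Suc-cong hyp₀)))

Suc-+ : (a b : Tm Γ 𝟘) → Γ ∣ H ⊢ Suc · a +ₒ b ≈ Suc · (a +ₒ b)
Suc-+ = ∀E₂ {A = Suc · v1 +ₒ v0 ≈ Suc · (v1 +ₒ v0)} (∀I (ind (compute refl)
  (≈-trans (+-Suc _ _) (≈-trans (Suc-cong hyp₀) (Suc-cong (≈-sym (+-Suc _ _)))))))

+-comm : (a b : Tm Γ 𝟘) → Γ ∣ H ⊢ a +ₒ b ≈ b +ₒ a
+-comm = ∀E₂ {A = v1 +ₒ v0 ≈ v0 +ₒ v1} (∀I (ind
  (≈-trans (+-identityʳ _) (≈-sym (+-identityˡ _)))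
  (≈-trans (+-Suc _ _) (≈-trans (Suc-cong hyp₀) (≈-sym (Suc-+ _ _))))))

+-assoc : (a b c : Tm Γ 𝟘) → Γ ∣ H ⊢ (a +ₒ b) +ₒ c ≈ a +ₒ (b +ₒ c)
+-assoc = ∀E₃ {A = (v2 +ₒ v1) +ₒ v0 ≈ v2 +ₒ (v1 +ₒ v0)} (∀I (∀I (ind
  (compute refl)
  (≈-trans (+-Suc _ _) (≈-trans (Suc-cong hyp₀) (compute refl))))))

*-zeroʳ : (a : Tm Γ 𝟘) → Γ ∣ H ⊢ a *ₒ O ≈ O
*-zeroʳ = ∀E {A = v0 *ₒ O ≈ O} (∀I (compute refl))

*-Suc : (a b : Tm Γ 𝟘) → Γ ∣ H ⊢ a *ₒ Suc · b ≈ a *ₒ b +ₒ a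
*-Suc = ∀E₂ {A = v1 *ₒ Suc · v0 ≈ v1 *ₒ v0 +ₒ v1} (∀I (∀I (compute refl)))

*-zeroˡ : (a : Tm Γ 𝟘) → Γ ∣ H ⊢ O *ₒ a ≈ O
*-zeroˡ = ∀E {A = O *ₒ v0 ≈ O} (ind
  (*-zeroʳ _)
  (≈-trans (*-Suc _ _) (≈-trans (+-identityʳ _) hyp₀)))

*-distribˡ-+ : (a b c : Tm Γ 𝟘) → Γ ∣ H ⊢ a *ₒ (b +ₒ c) ≈ a *ₒ b +ₒ a *ₒ c
*-distribˡ-+ = ∀E₃ {A = v2 *ₒ (v1 +ₒ v0) ≈ v2 *ₒ v1 +ₒ v2 *ₒ v0} (∀I (∀I (ind
  (compute refl)
  (v2 *ₒ (v1 +ₒ Suc · v0)          ≈⟨ compute refl ⟩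
   v2 *ₒ (v1 +ₒ v0) +ₒ v2          ≈⟨ +-cong hyp₀ ≈-refl′ ⟩
   (v2 *ₒ v1 +ₒ v2 *ₒ v0) +ₒ v2    ≈⟨ +-assoc _ _ _ ⟩
   v2 *ₒ v1 +ₒ (v2 *ₒ v0 +ₒ v2)    ≈⟨ compute refl ⟩
   v2 *ₒ v1 +ₒ v2 *ₒ Suc · v0      ∎))))

*-assoc : (a b c : Tm Γ 𝟘) → Γ ∣ H ⊢ (a *ₒ b) *ₒ c ≈ a *ₒ (b *ₒ c)
*-assoc = ∀E₃ {A = (v2 *ₒ v1) *ₒ v0 ≈ v2 *ₒ (v1 *ₒ v0)} (∀I (∀I (ind
  (compute refl)
  ((v2 *ₒ v1) *ₒ Suc · v0          ≈⟨ *-Suc _ _ ⟩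
   (v2 *ₒ v1) *ₒ v0 +ₒ v2 *ₒ v1    ≈⟨ +-cong hyp₀ ≈-refl′ ⟩
   v2 *ₒ (v1 *ₒ v0) +ₒ v2 *ₒ v1    ≈⟨ ≈-sym (*-distribˡ-+ _ _ _) ⟩
   v2 *ₒ (v1 *ₒ v0 +ₒ v1)          ≈⟨ compute refl ⟩
   v2 *ₒ (v1 *ₒ Suc · v0)          ∎))))

Suc-* : (a b : Tm Γ 𝟘) → Γ ∣ H ⊢ Suc · a *ₒ b ≈ a *ₒ b +ₒ b
Suc-* = ∀E₂ {A = Suc · v1 *ₒ v0 ≈ v1 *ₒ v0 +ₒ v0} (∀I (ind
  (compute refl)
  (Suc · v1 *ₒ Suc · v0            ≈⟨ compute refl ⟩
   Suc · (Suc · v1 *ₒ v0 +ₒ v1)    ≈⟨ Suc-cong (+-cong hyp₀ ≈-refl′) ⟩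
   Suc · (v1 *ₒ v0 +ₒ v0 +ₒ v1)    ≈⟨ Suc-cong (+-assoc _ _ _) ⟩
   Suc · (v1 *ₒ v0 +ₒ (v0 +ₒ v1))
     ≈⟨ Suc-cong (+-cong ≈-refl′ (+-comm _ _)) ⟩
   Suc · (v1 *ₒ v0 +ₒ (v1 +ₒ v0))  ≈⟨ Suc-cong (≈-sym (+-assoc _ _ _)) ⟩
   Suc · (v1 *ₒ v0 +ₒ v1 +ₒ v0)    ≈⟨ compute refl ⟩
   v1 *ₒ Suc · v0 +ₒ Suc · v0      ∎)))

*-comm : (a b : Tm Γ 𝟘) → Γ ∣ H ⊢ a *ₒ b ≈ b *ₒ a
*-comm = ∀E₂ {A = v1 *ₒ v0 ≈ v0 *ₒ v1} (∀I (ind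
  (≈-trans (*-zeroʳ _) (≈-sym (*-zeroˡ _)))
  (≈-trans (*-Suc _ _) (≈-trans (+-cong hyp₀ ≈-refl′) (≈-sym (Suc-* _ _))))))

-- The semiring of terms and its solver

+-*-commutativeSemiring : (Γ : Ctx) → List (Form Γ) → CommutativeSemiring 0ℓ 0ℓ
+-*-commutativeSemiring Γ H = record
  { Carrier = Tm Γ 𝟘
  ; _≈_ = λ a b → Γ ∣ H ⊢ a ≈ b
  ; _+_ = _+ₒ_
  ; _*_ = _*ₒ_
  ; 0# = O
  ; 1# = numeral 1
  ; isCommutativeSemiring = isCommutativeSemiringˡ (record
    { +-isCommutativeMonoid = isCommutativeMonoidˡ (record
      { isSemigroup = record
        { isMagma = record { isEquivalence = isEquivalence ; ∙-cong = +-cong }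
        ; assoc = +-assoc
        }
      ; identityˡ = +-identityˡ
      ; comm = +-comm
      })
    ; *-isCommutativeMonoid = isCommutativeMonoidˡ (record
      { isSemigroup = record
        { isMagma = record { isEquivalence = isEquivalence ; ∙-cong = *-cong }
        ; assoc = *-assoc
        }
      ; identityˡ = λ a → ≈-trans (Suc-* _ _)
          (≈-trans (+-cong (*-zeroˡ _) ≈-refl′) (+-identityˡ _))
      ; comm = *-comm
      })
    ; distribʳ = λ a b c → ≈-trans (*-comm _ _)
        (≈-trans (*-distribˡ-+ _ _ _) (+-cong (*-comm _ _) (*-comm _ _)))
    ; zeroˡ = *-zeroˡ
    })
  }
  where
  isEquivalence : IsEquivalence (λ a b → Γ ∣ H ⊢ a ≈ b)
  isEquivalence = record { refl = ≈-refl′ ; sym = ≈-sym ; trans = ≈-trans }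

numeral-+ : ∀ m n → Γ ∣ H ⊢ numeral (m ℕ.+ n) ≈ numeral m +ₒ numeral n
numeral-+ zero    n = ≈-sym (+-identityˡ _)
numeral-+ (suc m) n = ≈-trans (Suc-cong (numeral-+ m n)) (≈-sym (Suc-+ _ _))

numeral-* : ∀ m n → Γ ∣ H ⊢ numeral (m ℕ.* n) ≈ numeral m *ₒ numeral n
numeral-* zero    n = ≈-sym (*-zeroˡ _)
numeral-* (suc m) n = ≈-trans (numeral-+ n (m ℕ.* n))
  (≈-trans (+-cong ≈-refl′ (numeral-* m n))
    (≈-trans (+-comm _ _) (≈-sym (Suc-* _ _))))

-- With ℕ as coefficients, constants are added and multiplied at the metalevel. Negation is the
-- identity, which is how a semiring counts as an almost commutative ring.
module Solver {Γ : Ctx} {H : List (Form Γ)} where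

  private
    ℕ-rawRing : RawRing 0ℓ 0ℓ
    ℕ-rawRing = record
      { Carrier = ℕ ; _≈_ = _≡_ ; _+_ = ℕ._+_ ; _*_ = ℕ._*_ ; -_ = λ n → n
      ; 0# = 0 ; 1# = 1 }

    numeral-homo : ℕ-rawRing -Raw-AlmostCommutative⟶
                   fromCommutativeSemiring (+-*-commutativeSemiring Γ H)
    numeral-homo = record
      { ⟦_⟧ = numeral ; +-homo = numeral-+ ; *-homo = numeral-*
      ; -‿homo = λ _ → ≈-refl′ ; 0-homo = ≈-refl′ ; 1-homo = ≈-refl′ }

    _≟_ : ∀ m n → Maybe (Γ ∣ H ⊢ numeral m ≈ numeral n)
    m ≟ n = Maybe.map (λ { refl → ≈-refl′ }) (dec⇒weaklyDec ℕ._≟_ m n)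

  open import Algebra.Solver.Ring _ _ numeral-homo _≟_ public

case-ℕ : {A : Form (𝟘 ∷ Γ)} → Γ ∣ H ⊢ A [ O ] →
         𝟘 ∷ Γ ∣ map wk H ⊢ A [↦ Suc · v0 ] → Γ ∣ H ⊢ ∀̇ 𝟘 A
case-ℕ p q = ind p (weaken there q)

-- Truncated subtraction and the order

∸-zeroʳ : (a : Tm Γ 𝟘) → Γ ∣ H ⊢ a ∸ₒ O ≈ a
∸-zeroʳ = ∀E {A = v0 ∸ₒ O ≈ v0} (∀I (compute refl))

∸-zeroˡ : (a : Tm Γ 𝟘) → Γ ∣ H ⊢ O ∸ₒ a ≈ O
∸-zeroˡ = ∀E {A = O ∸ₒ v0 ≈ O} (ind
  (∸-zeroʳ _)
  (O ∸ₒ Suc · v0               ≈⟨ compute refl ⟩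
   closed pred · (O ∸ₒ v0)     ≈⟨ pred-cong hyp₀ ⟩
   closed pred · O             ≈⟨ compute refl ⟩
   O                           ∎))

Suc∸Suc : (a b : Tm Γ 𝟘) → Γ ∣ H ⊢ Suc · a ∸ₒ Suc · b ≈ a ∸ₒ b
Suc∸Suc = ∀E₂ {A = Suc · v1 ∸ₒ Suc · v0 ≈ v1 ∸ₒ v0} (∀I (ind
  (compute refl)
  (Suc · v1 ∸ₒ Suc · (Suc · v0)             ≈⟨ compute refl ⟩
   closed pred · (Suc · v1 ∸ₒ Suc · v0)     ≈⟨ pred-cong hyp₀ ⟩
   closed pred · (v1 ∸ₒ v0)                 ≈⟨ compute refl ⟩
   v1 ∸ₒ Suc · v0                           ∎)))

+-∸ : (a b : Tm Γ 𝟘) → Γ ∣ H ⊢ (a +ₒ b) ∸ₒ b ≈ a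
+-∸ = ∀E₂ {A = (v1 +ₒ v0) ∸ₒ v0 ≈ v1} (∀I (ind
  (compute refl)
  (≈-trans (∸-cong (+-Suc _ _) ≈-refl′) (≈-trans (Suc∸Suc _ _) hyp₀))))

∸-self : (a : Tm Γ 𝟘) → Γ ∣ H ⊢ a ∸ₒ a ≈ O
∸-self a = ≈-trans (∸-cong (≈-sym (+-identityˡ a)) ≈-refl′) (+-∸ O a)

m≤m+n : (a b : Tm Γ 𝟘) → Γ ∣ H ⊢ a ≤₀ a +ₒ b
m≤m+n = ∀E₂ {A = v1 ≤₀ v1 +ₒ v0} (∀I (ind
  (≈-trans (∸-cong ≈-refl′ (+-identityʳ _)) (∸-self _))
  (v1 ∸ₒ (v1 +ₒ Suc · v0)            ≈⟨ compute refl ⟩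
   closed pred · (v1 ∸ₒ (v1 +ₒ v0))  ≈⟨ pred-cong hyp₀ ⟩
   closed pred · O                   ≈⟨ compute refl ⟩
   O                                 ∎)))

-- As `maxₒ a b` is a + (b ∸ a), commutativity yields b = a + (b ∸ a) for a ≤ b, which gives the
-- order explicit differences. The second variable stays quantified in the induction so that both
-- arguments can decrease together.
max-comm : (a b : Tm Γ 𝟘) → Γ ∣ H ⊢ maxₒ a b ≈ maxₒ b a
max-comm = ∀E₂ {A = maxₒ v1 v0 ≈ maxₒ v0 v1} (ind
  (∀I (≈-trans (+-cong ≈-refl′ (∸-zeroʳ _)) (≈-trans (+-identityˡ _)
    (≈-sym (≈-trans (+-cong ≈-refl′ (∸-zeroˡ _)) (+-identityʳ _))))))
  (case-ℕ
    (≈-trans (+-cong ≈-refl′ (∸-zeroˡ _)) (≈-trans (+-identityʳ _)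
      (≈-sym (≈-trans (+-cong ≈-refl′ (∸-zeroʳ _)) (+-identityˡ _)))))
    (≈-trans (+-cong ≈-refl′ (Suc∸Suc _ _)) (≈-trans (Suc-+ _ _)
      (≈-trans (Suc-cong (∀E hyp₀ v0)) (≈-sym
        (≈-trans (+-cong ≈-refl′ (Suc∸Suc _ _)) (Suc-+ _ _))))))))

≤-total : (a b : Tm Γ 𝟘) → Γ ∣ H ⊢ a ≤₀ b ∨̇ Suc · b ≤₀ a
≤-total = ∀E₂ {A = v1 ≤₀ v0 ∨̇ Suc · v0 ≤₀ v1} (ind
  (∀I (∨I₁ (∸-zeroˡ _)))
  (case-ℕ
    (∨I₂ (≈-trans (Suc∸Suc _ _) (∸-zeroˡ _)))
    (∨E (∀E hyp₀ v0)
      (∨I₁ (≈-trans (Suc∸Suc _ _) hyp₀))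
      (∨I₂ (≈-trans (Suc∸Suc _ _) hyp₀)))))

≤⇒+ : Γ ∣ H ⊢ a ≤₀ b → Γ ∣ H ⊢ b ≈ a +ₒ (b ∸ₒ a)
≤⇒+ {a = a} {b = b} p =
  b              ≈⟨ ≈-sym (+-identityʳ b) ⟩
  b +ₒ O         ≈⟨ +-cong ≈-refl′ (≈-sym p) ⟩
  maxₒ b a       ≈⟨ max-comm b a ⟩
  a +ₒ (b ∸ₒ a)  ∎

≤-cong : Γ ∣ H ⊢ a ≈ a′ → Γ ∣ H ⊢ b ≈ b′ → Γ ∣ H ⊢ a ≤₀ b → Γ ∣ H ⊢ a′ ≤₀ b′
≤-cong p q r = ≈-trans (∸-cong (≈-sym p) (≈-sym q)) r

+⇒≤ : (c : Tm Γ 𝟘) → Γ ∣ H ⊢ b ≈ a +ₒ c → Γ ∣ H ⊢ a ≤₀ b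
+⇒≤ c p = ≤-cong ≈-refl′ (≈-sym p) (m≤m+n _ c)

≤-reflexive : Γ ∣ H ⊢ a ≈ b → Γ ∣ H ⊢ a ≤₀ b
≤-reflexive p = ≤-cong ≈-refl′ p (∸-self _)

+-cancelʳ : (c : Tm Γ 𝟘) → Γ ∣ H ⊢ a +ₒ c ≈ b +ₒ c → Γ ∣ H ⊢ a ≈ b
+-cancelʳ c p =
  ≈-trans (≈-sym (+-∸ _ c)) (≈-trans (∸-cong p ≈-refl′) (+-∸ _ c))

-- If b - a = (e - c) + d then c ≤ e implies a ≤ b; the identity is stated
-- without subtraction.
≤-linear : (d : Tm Γ 𝟘) → Γ ∣ H ⊢ c ≤₀ e → Γ ∣ H ⊢ a +ₒ e +ₒ d ≈ b +ₒ c →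
           Γ ∣ H ⊢ a ≤₀ b
≤-linear {c = c} {e = e} {a = a} {b = b} d p q = +⇒≤ (e ∸ₒ c +ₒ d) (+-cancelʳ c
  (b +ₒ c                        ≈⟨ ≈-sym q ⟩
   a +ₒ e +ₒ d                   ≈⟨ +-cong (+-cong ≈-refl′ (≤⇒+ p)) ≈-refl′ ⟩
   a +ₒ (c +ₒ (e ∸ₒ c)) +ₒ d
     ≈⟨ solve 4 (λ a c f d →
          a :+ (c :+ f) :+ d := a :+ (f :+ d) :+ c) ≈-refl′ a c (e ∸ₒ c) d ⟩
   a +ₒ (e ∸ₒ c +ₒ d) +ₒ c       ∎))
  where open Solver

+-mono-≤ : Γ ∣ H ⊢ a ≤₀ b → Γ ∣ H ⊢ c ≤₀ d → Γ ∣ H ⊢ a +ₒ c ≤₀ b +ₒ d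
+-mono-≤ {a = a} {b = b} {c = c} {d = d} p q =
  +⇒≤ (b ∸ₒ a +ₒ (d ∸ₒ c)) (≈-trans (+-cong (≤⇒+ p) (≤⇒+ q))
    (solve 4 (λ a c f g → (a :+ f) :+ (c :+ g) := (a :+ c) :+ (f :+ g)) ≈-refl′
      a c (b ∸ₒ a) (d ∸ₒ c)))
  where open Solver

≤-refl : Γ ∣ H ⊢ a ≤₀ a
≤-refl = ≤-reflexive ≈-refl′

≤-trans : Γ ∣ H ⊢ a ≤₀ b → Γ ∣ H ⊢ b ≤₀ c → Γ ∣ H ⊢ a ≤₀ c
≤-trans {a = a} {b = b} {c = c} p q = ≤-linear O (+-mono-≤ p q)
  (solve 3 (λ a b c → a :+ (b :+ c) :+ con 0 := c :+ (a :+ b)) ≈-refl′ a b c)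
  where open Solver

0≤n : Γ ∣ H ⊢ O ≤₀ a
0≤n = ∸-zeroˡ _

n≤0⇒n≈0 : Γ ∣ H ⊢ a ≤₀ O → Γ ∣ H ⊢ a ≈ O
n≤0⇒n≈0 p = ≈-trans (≈-sym (∸-zeroʳ _)) p

1≰0 : Γ ∣ H ⊢ numeral 1 ≤₀ O → Γ ∣ H ⊢ ⊥̇
1≰0 p = ⊃E (axiom (base (Suc≢O O))) (n≤0⇒n≈0 p)

+1≈Suc : (a : Tm Γ 𝟘) → Γ ∣ H ⊢ a +ₒ numeral 1 ≈ Suc · a
+1≈Suc = ∀E {A = v0 +ₒ numeral 1 ≈ Suc · v0} (∀I (compute refl))

-- The strict case reads b + 1 instead of `Suc · b` because the solver's polynomials contain sums
-- but not `Suc`.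
≤-cases : (a b : Tm Γ 𝟘) → Γ ∣ (a ≤₀ b) ∷ H ⊢ C →
          Γ ∣ (b +ₒ numeral 1 ≤₀ a) ∷ H ⊢ C → Γ ∣ H ⊢ C
≤-cases a b p q = ∨E (≤-total a b) p
  (⊃E (weaken there (⊃I q)) (≤-cong (≈-sym (+1≈Suc _)) ≈-refl′ hyp₀))

-- With 1 ≤ 0 as the goal, `≤-linear` only asks for a combination of the available inequalities,
-- with multipliers, that is contradictory.
≤-by-contradiction : Γ ∣ (b +ₒ numeral 1 ≤₀ a) ∷ H ⊢ numeral 1 ≤₀ O →
                     Γ ∣ H ⊢ a ≤₀ b
≤-by-contradiction p = ≤-cases _ _ hyp₀ (⊥E (1≰0 p))

m+1≤n⇒m≤n : Γ ∣ H ⊢ a +ₒ numeral 1 ≤₀ b → Γ ∣ H ⊢ a ≤₀ b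
m+1≤n⇒m≤n p = ≤-trans (m≤m+n _ _) p

≤-antisym : Γ ∣ H ⊢ a ≤₀ b → Γ ∣ H ⊢ b ≤₀ a → Γ ∣ H ⊢ a ≈ b
≤-antisym {a = a} {b = b} p q =
  a              ≈⟨ ≈-sym (+-identityʳ a) ⟩
  a +ₒ O         ≈⟨ +-cong ≈-refl′ (≈-sym q) ⟩
  a +ₒ (b ∸ₒ a)  ≈⟨ ≈-sym (≤⇒+ p) ⟩
  b              ∎

*-monoˡ-≤ : (c : Tm Γ 𝟘) → Γ ∣ H ⊢ a ≤₀ b → Γ ∣ H ⊢ a *ₒ c ≤₀ b *ₒ c
*-monoˡ-≤ {a = a} {b = b} c p = +⇒≤ ((b ∸ₒ a) *ₒ c)
  (≈-trans (*-cong (≤⇒+ p) ≈-refl′)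
    (solve 3 (λ a f c → (a :+ f) :* c := a :* c :+ f :* c) ≈-refl′ a (b ∸ₒ a) c))
  where open Solver

m+n∸m≈n : (a b : Tm Γ 𝟘) → Γ ∣ H ⊢ (a +ₒ b) ∸ₒ a ≈ b
m+n∸m≈n a b = ≈-trans (∸-cong (+-comm a b) ≈-refl′) (+-∸ b a)

m∸n≤m : (a b : Tm Γ 𝟘) → Γ ∣ H ⊢ a ∸ₒ b ≤₀ a
m∸n≤m a b = ≤-cases a b
  (≤-cong (≈-sym hyp₀) ≈-refl′ 0≤n)
  (+⇒≤ b (≈-trans (≤⇒+ (m+1≤n⇒m≤n hyp₀)) (+-comm _ _)))

minₒ≤ʳ : (a b : Tm Γ 𝟘) → Γ ∣ H ⊢ minₒ a b ≤₀ b
minₒ≤ʳ a b = ≤-cases a b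
  (≤-cong (≈-sym (≈-trans (∸-cong ≈-refl′ hyp₀) (∸-zeroʳ a))) ≈-refl′ hyp₀)
  (≤-reflexive (≈-trans (∸-cong (≤⇒+ (m+1≤n⇒m≤n hyp₀)) ≈-refl′) (+-∸ b (a ∸ₒ b))))

-- Floor division

quot-Suc : (n k : Tm Γ 𝟘) → Γ ∣ H ⊢ ⌊ Suc · n /suc k ⌋ ≈
  ⌊ n /suc k ⌋ +ₒ
    (numeral 1 ∸ₒ ((Suc · ⌊ n /suc k ⌋) *ₒ (Suc · k) ∸ₒ Suc · n))
quot-Suc = ∀E₂ {A = ⌊ Suc · v1 /suc v0 ⌋ ≈
  ⌊ v1 /suc v0 ⌋ +ₒ
    (numeral 1 ∸ₒ ((Suc · ⌊ v1 /suc v0 ⌋) *ₒ (Suc · v0) ∸ₒ Suc · v1))}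
  (∀I (∀I (compute refl)))

-- The next multiple T = (q + 1)(k + 1) decides the induction step: if T ≤ n + 1, the quotient grows
-- and T ≤ n + 1 is its new lower bound; otherwise the quotient stays and n + 2 ≤ T is its new upper
-- bound.
quot-bounds : (k n : Tm Γ 𝟘) → Γ ∣ H ⊢
  ⌊ n /suc k ⌋ *ₒ (k +ₒ numeral 1) ≤₀ n ∧̇
  n +ₒ numeral 1 ≤₀ (⌊ n /suc k ⌋ +ₒ numeral 1) *ₒ (k +ₒ numeral 1)
quot-bounds {Γ} = ∀E₂ {A =
  ⌊ v0 /suc v1 ⌋ *ₒ (v1 +ₒ numeral 1) ≤₀ v0 ∧̇
  v0 +ₒ numeral 1 ≤₀ (⌊ v0 /suc v1 ⌋ +ₒ numeral 1) *ₒ (v1 +ₒ numeral 1)}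
  (∀I (ind
    (∧I (≤-reflexive (≈-trans (*-cong q₀ ≈-refl′) (*-zeroˡ _)))
        (≤-cong ≈-refl′ (*-cong (+-cong (≈-sym q₀) ≈-refl′) ≈-refl′)
          (+⇒≤ v0 (solve 1 (λ k → (con 0 :+ con 1) :* (k :+ con 1) :=
            con 0 :+ con 1 :+ k) ≈-refl′ v0))))
    (≤-cases T (Suc · v0)
      (∧I (≤-cong (*-cong (≈-sym q₁) ≈-refl′) ≈-refl′
            (≤-cong T≈ ≈-refl′ hyp₀))
          (≤-cong (+-cong (+1≈Suc v0) ≈-refl′)
            (*-cong (+-cong (≈-sym q₁) ≈-refl′) ≈-refl′)
            (≤-linear v1 (∧E₂ (weaken there hyp₀))
              (solve 3 (λ n q k →
                n :+ con 1 :+ con 1 :+ (q :+ con 1) :* (k :+ con 1) :+ k :=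
                (q :+ con 1 :+ con 1) :* (k :+ con 1) :+ (n :+ con 1))
                ≈-refl′ v0 q v1))))
      (∧I (≤-cong (*-cong (≈-sym q₂) ≈-refl′) (+1≈Suc v0)
            (≤-trans (∧E₁ (weaken there hyp₀)) (m≤m+n _ _)))
          (≤-cong ≈-refl′
            (≈-trans T≈ (*-cong (+-cong (≈-sym q₂) ≈-refl′) ≈-refl′)) hyp₀)))))
  where
  open Solver
  q T : Tm (𝟘 ∷ 𝟘 ∷ Γ) 𝟘
  q = ⌊ v0 /suc v1 ⌋
  T = (Suc · q) *ₒ (Suc · v1)
  T≈ : _ ∣ H ⊢ T ≈ (q +ₒ numeral 1) *ₒ (v1 +ₒ numeral 1)
  T≈ = *-cong (≈-sym (+1≈Suc _)) (≈-sym (+1≈Suc _))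
  q₀ : 𝟘 ∷ Γ ∣ H ⊢ ⌊ O /suc v0 ⌋ ≈ O
  q₀ = compute refl
  q₁ : _ ∣ (T ≤₀ Suc · v0) ∷ H ⊢ ⌊ Suc · v0 /suc v1 ⌋ ≈ q +ₒ numeral 1
  q₁ = ≈-trans (quot-Suc _ _) (+-cong ≈-refl′
    (≈-trans (∸-cong ≈-refl′ hyp₀) (∸-zeroʳ _)))
  1≤T∸ : _ ∣ (Suc · v0 +ₒ numeral 1 ≤₀ T) ∷ H ⊢ numeral 1 ≤₀ T ∸ₒ Suc · v0
  1≤T∸ = ≤-cong ≈-refl′
    (≈-sym (≈-trans (∸-cong (≈-trans (≤⇒+ hyp₀) (+-assoc _ _ _)) ≈-refl′)
      (m+n∸m≈n _ _)))
    (m≤m+n _ _)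
  q₂ : _ ∣ (Suc · v0 +ₒ numeral 1 ≤₀ T) ∷ H ⊢ ⌊ Suc · v0 /suc v1 ⌋ ≈ q
  -- `numeral 1 ≤₀ x` unfolds to `numeral 1 ∸ₒ x ≈ O`, so this inequality itself rewrites the
  -- increment to 0.
  q₂ = ≈-trans (quot-Suc _ _) (≈-trans (+-cong ≈-refl′ 1≤T∸) (+-identityʳ _))

≤-quot : Γ ∣ H ⊢ m *ₒ (k +ₒ numeral 1) ≤₀ n → Γ ∣ H ⊢ m ≤₀ ⌊ n /suc k ⌋
≤-quot {m = m} {k = k} {n = n} p = ≤-by-contradiction
  (≤-linear O
    (+-mono-≤ (+-mono-≤ (*-monoˡ-≤ (k +ₒ numeral 1) hyp₀) (weaken there p))
      (∧E₂ (quot-bounds k n)))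
    (solve 4 (λ m q k n → con 1 :+ (m :* (k :+ con 1) :+ n :+
         (q :+ con 1) :* (k :+ con 1)) :+ con 0 :=
       con 0 :+ ((q :+ con 1) :* (k :+ con 1) :+ m :* (k :+ con 1) :+
         (n :+ con 1))) ≈-refl′ m ⌊ n /suc k ⌋ k n))
  where open Solver

quot-≤ : Γ ∣ H ⊢ n +ₒ numeral 1 ≤₀ (m +ₒ numeral 1) *ₒ (k +ₒ numeral 1) →
         Γ ∣ H ⊢ ⌊ n /suc k ⌋ ≤₀ m
quot-≤ {n = n} {m = m} {k = k} p = ≤-by-contradiction
  (≤-linear O
    (+-mono-≤ (+-mono-≤ (*-monoˡ-≤ (k +ₒ numeral 1) hyp₀) (weaken there p))
      (∧E₁ (quot-bounds k n)))
    (solve 4 (λ m q k n → con 1 :+ (q :* (k :+ con 1) :+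
         (m :+ con 1) :* (k :+ con 1) :+ n) :+ con 0 :=
       con 0 :+ ((m :+ con 1) :* (k :+ con 1) :+ (n :+ con 1) :+
         q :* (k :+ con 1))) ≈-refl′ m ⌊ n /suc k ⌋ k n))
  where open Solver

quot-small : Γ ∣ H ⊢ n ≤₀ k → Γ ∣ H ⊢ ⌊ n /suc k ⌋ ≈ O
quot-small {n = n} {k = k} p = n≤0⇒n≈0 (quot-≤ (≤-linear O p
  (solve 2 (λ n k → n :+ con 1 :+ k :+ con 0 :=
    (con 0 :+ con 1) :* (k :+ con 1) :+ n) ≈-refl′ n k)))
  where open Solver

-- Halving and integer codes

half odd : Tm Γ 𝟘 → Tm Γ 𝟘
half n = ⌊ n /suc numeral 1 ⌋
odd n = numeral 2 *ₒ n +ₒ numeral 1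

half-cong : Γ ∣ H ⊢ a ≈ b → Γ ∣ H ⊢ half a ≈ half b
half-cong p = ·-cong₂ (closed quot) p ≈-refl′

half-odd : (a : Tm Γ 𝟘) → Γ ∣ H ⊢ half (odd a) ≈ a
half-odd a = ≤-antisym
  (quot-≤ (≤-reflexive (solve 1 (λ a → con 2 :* a :+ con 1 :+ con 1 :=
    (a :+ con 1) :* (con 1 :+ con 1)) ≈-refl′ a)))
  (≤-quot (+⇒≤ (numeral 1) (solve 1 (λ a → con 2 :* a :+ con 1 :=
    a :* (con 1 :+ con 1) :+ con 1) ≈-refl′ a)))
  where open Solver

posPart-half : (a : Tm Γ 𝟘) → Γ ∣ H ⊢ closed posPart · a ≈
  (numeral 1 ∸ₒ (a ∸ₒ numeral 2 *ₒ half a)) *ₒ half a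
posPart-half = ∀E {A = closed posPart · v0 ≈
  (numeral 1 ∸ₒ (v0 ∸ₒ numeral 2 *ₒ half v0)) *ₒ half v0} (∀I (compute refl))

negPart-half : (a : Tm Γ 𝟘) → Γ ∣ H ⊢ closed negPart · a ≈
  (a ∸ₒ numeral 2 *ₒ half a) *ₒ (Suc · half a)
negPart-half = ∀E {A = closed negPart · v0 ≈
  (v0 ∸ₒ numeral 2 *ₒ half v0) *ₒ (Suc · half v0)} (∀I (compute refl))

posPart≤half : (a : Tm Γ 𝟘) → Γ ∣ H ⊢ closed posPart · a ≤₀ half a
posPart≤half a = ≤-cong (≈-sym (posPart-half a)) (*-identityˡ (half a))
  (*-monoˡ-≤ (half a) (m∸n≤m _ _))
  where
  open CommutativeSemiring (+-*-commutativeSemiring _ _) using (*-identityˡ)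

parity-odd : (a : Tm Γ 𝟘) → Γ ∣ H ⊢ odd a ∸ₒ numeral 2 *ₒ half (odd a) ≈ numeral 1
parity-odd a = ≈-trans (∸-cong ≈-refl′ (*-cong ≈-refl′ (half-odd a)))
  (m+n∸m≈n _ _)

posPart-odd : (a : Tm Γ 𝟘) → Γ ∣ H ⊢ closed posPart · odd a ≈ O
posPart-odd a = ≈-trans (posPart-half _) (≈-trans
  (*-cong (≈-trans (∸-cong ≈-refl′ (parity-odd a)) (∸-self _)) ≈-refl′)
  (*-zeroˡ _))

negPart-odd : (a : Tm Γ 𝟘) → Γ ∣ H ⊢ closed negPart · odd a ≈ Suc · a
negPart-odd a = ≈-trans (negPart-half _) (≈-trans
  (*-cong (parity-odd a) (Suc-cong (half-odd a)))
  (*-identityˡ (Suc · a)))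
  where
  open CommutativeSemiring (+-*-commutativeSemiring _ _) using (*-identityˡ)

code-≤ : Γ ∣ H ⊢ b ≤₀ a → Γ ∣ H ⊢ code a b ≈ numeral 2 *ₒ (a ∸ₒ b)
code-≤ p = ≈-trans
  (+-cong ≈-refl′ (≈-trans
    (∸-cong (≈-trans (*-cong ≈-refl′ p) (*-zeroʳ _)) ≈-refl′) (∸-zeroˡ _)))
  (+-identityʳ _)

code-> : Γ ∣ H ⊢ a +ₒ numeral 1 ≤₀ b →
         Γ ∣ H ⊢ code a b ≈ odd (b ∸ₒ (a +ₒ numeral 1))
code-> {a = a} {b = b} p =
  code a b
    ≈⟨ +-cong (≈-trans (*-cong ≈-refl′ (m+1≤n⇒m≤n p)) (*-zeroʳ _)) ≈-refl′ ⟩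
  O +ₒ (numeral 2 *ₒ (b ∸ₒ a) ∸ₒ numeral 1)
    ≈⟨ +-identityˡ _ ⟩
  numeral 2 *ₒ (b ∸ₒ a) ∸ₒ numeral 1
    ≈⟨ ∸-cong (*-cong ≈-refl′ (≈-trans
         (∸-cong (≈-trans (≤⇒+ p) (+-assoc _ _ _)) ≈-refl′) (m+n∸m≈n _ _)))
         ≈-refl′ ⟩
  numeral 2 *ₒ (numeral 1 +ₒ δ) ∸ₒ numeral 1
    ≈⟨ ∸-cong (solve 1 (λ c → con 2 :* (con 1 :+ c) :=
         con 2 :* c :+ con 1 :+ con 1) ≈-refl′ δ) ≈-refl′ ⟩
  odd δ +ₒ numeral 1 ∸ₒ numeral 1
    ≈⟨ +-∸ _ _ ⟩
  odd δ ∎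
  where
  open Solver
  δ : Tm _ 𝟘
  δ = b ∸ₒ (a +ₒ numeral 1)

-- For b ≤ a the code is the even number 2(a - b), whose half bounds the positive part. For a < b it
-- is the odd number 2(b - a - 1) + 1, which decodes exactly to a - b. This starts the induction in
-- `digits-upper`.
code-upper : (a b : Tm Γ 𝟘) → Γ ∣ H ⊢
  closed posPart · code a b +ₒ b ≤₀ a +ₒ closed negPart · code a b
code-upper a b = ≤-cases b a
  -- In the even case the positive part alone gives the bound; the negative part is the slack.
  (≤-linear (closed negPart · code a b)
    (≤-trans (posPart≤half _)
      (≤-trans (≤-reflexive (half-cong (code-≤ hyp₀)))
        (quot-≤ (+⇒≤ (numeral 1) (solve 1 (λ c →
          (c :+ con 1) :* (con 1 :+ con 1) := con 2 :* c :+ con 1 :+ con 1)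
          ≈-refl′ (a ∸ₒ b))))))
    (≈-trans
      (solve 4 (λ p b c n → p :+ b :+ c :+ n := b :+ c :+ n :+ p) ≈-refl′
        (closed posPart · code a b) b (a ∸ₒ b) (closed negPart · code a b))
      (+-cong (+-cong (≈-sym (≤⇒+ hyp₀)) ≈-refl′) ≈-refl′)))
  (≤-reflexive
    (closed posPart · code a b +ₒ b
       ≈⟨ +-cong (≈-trans (·-cong (closed posPart) (code-> hyp₀)) (posPart-odd δ))
            (≤⇒+ hyp₀) ⟩
     O +ₒ (a +ₒ numeral 1 +ₒ δ)
       ≈⟨ solve 2 (λ a c → con 0 :+ (a :+ con 1 :+ c) := a :+ (c :+ con 1))
            ≈-refl′ a δ ⟩
     a +ₒ (δ +ₒ numeral 1)
       ≈⟨ +-cong ≈-refl′ (≈-trans (+1≈Suc δ) (≈-sym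
            (≈-trans (·-cong (closed negPart) (code-> hyp₀)) (negPart-odd δ)))) ⟩
     a +ₒ closed negPart · code a b ∎))
  where
  open Solver
  δ : Tm _ 𝟘
  δ = b ∸ₒ (a +ₒ numeral 1)

-- Partial sums of signed digit representations

up-O : (γ : Tm Γ 𝟙) → Γ ∣ H ⊢ up γ O ≈ closed posPart · (γ · O)
up-O = ∀E {A = up v0 O ≈ closed posPart · (v0 · O)} (∀I (compute refl))

down-O : (γ : Tm Γ 𝟙) → Γ ∣ H ⊢ down γ O ≈ closed negPart · (γ · O)
down-O = ∀E {A = down v0 O ≈ closed negPart · (v0 · O)} (∀I (compute refl))

up-Suc : (γ : Tm Γ 𝟙) (n : Tm Γ 𝟘) → Γ ∣ H ⊢
  up γ (Suc · n) ≈ up γ n +ₒ up γ n +ₒ minₒ (γ · (Suc · n)) (numeral 2)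
up-Suc = ∀E₂ {A =
  up v1 (Suc · v0) ≈ up v1 v0 +ₒ up v1 v0 +ₒ minₒ (v1 · (Suc · v0)) (numeral 2)}
  (∀I (∀I (compute refl)))

down-Suc : (γ : Tm Γ 𝟙) (n : Tm Γ 𝟘) → Γ ∣ H ⊢
  down γ (Suc · n) ≈ down γ n +ₒ down γ n +ₒ numeral 1
down-Suc = ∀E₂ {A =
  down v1 (Suc · v0) ≈ down v1 v0 +ₒ down v1 v0 +ₒ numeral 1}
  (∀I (∀I (compute refl)))

digitsₜ : Tm Γ 𝟙 → Tm Γ 𝟙 → Tm Γ 𝟙
digitsₜ p q = closed digits · p · q

digits-O : (p q : Tm Γ 𝟙) → Γ ∣ H ⊢ digitsₜ p q · O ≈ code (p · O) (q · O)
digits-O = ∀E₂ {A = digitsₜ v1 v0 · O ≈ code (v1 · O) (v0 · O)}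
  (∀I (∀I (compute refl)))

digits-Suc : (p q : Tm Γ 𝟙) (n : Tm Γ 𝟘) → Γ ∣ H ⊢ digitsₜ p q · (Suc · n) ≈
  (p · (Suc · n) +ₒ numeral 2 *ₒ (q · n) +ₒ numeral 1) ∸ₒ
  (numeral 2 *ₒ (p · n) +ₒ q · (Suc · n))
digits-Suc = ∀E₃ {A = digitsₜ v2 v1 · (Suc · v0) ≈
  (v2 · (Suc · v0) +ₒ numeral 2 *ₒ (v1 · v0) +ₒ numeral 1) ∸ₒ
  (numeral 2 *ₒ (v2 · v0) +ₒ v1 · (Suc · v0))}
  (∀I (∀I (∀I (compute refl))))

-- With A = p - q the premise is A(n+1) ≥ 2A(n) - 1, so the truncated subtraction in the digit
-- A(n+1) - 2A(n) + 1 is exact. Capping the digit at 2 can only lower it, hence the partial sums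
-- satisfy P(n+1) ≤ 2P(n) + A(n+1) - 2A(n), and P(n) ≤ A(n) is inherited.
digits-upper : (p q : Tm Γ 𝟙) → Γ ∣ H ⊢
  ∀̇ 𝟘 (numeral 2 *ₒ (wkᵗ p · v0) +ₒ wkᵗ q · (Suc · v0) ≤₀
       wkᵗ p · (Suc · v0) +ₒ numeral 2 *ₒ (wkᵗ q · v0) +ₒ numeral 1) ⊃
  ∀̇ 𝟘 (up (digitsₜ (wkᵗ p) (wkᵗ q)) v0 +ₒ wkᵗ q · v0 ≤₀
       wkᵗ p · v0 +ₒ down (digitsₜ (wkᵗ p) (wkᵗ q)) v0)
digits-upper {Γ = Γ} = ∀E₂ {A =
  ∀̇ 𝟘 (numeral 2 *ₒ (v2 · v0) +ₒ v1 · (Suc · v0) ≤₀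
       v2 · (Suc · v0) +ₒ numeral 2 *ₒ (v1 · v0) +ₒ numeral 1) ⊃
  ∀̇ 𝟘 (up (digitsₜ v2 v1) v0 +ₒ v1 · v0 ≤₀ v2 · v0 +ₒ down (digitsₜ v2 v1) v0)}
  (∀I (∀I (⊃I (ind
    (≤-cong
      (+-cong (≈-sym (≈-trans (up-O _) (·-cong _ (digits-O _ _)))) ≈-refl′)
      (+-cong ≈-refl′ (≈-sym (≈-trans (down-O _) (·-cong _ (digits-O _ _)))))
      (code-upper _ _))
    (≤-cong
      (+-cong (≈-sym (up-Suc γ v0)) ≈-refl′)
      (+-cong ≈-refl′ (≈-sym (down-Suc γ v0)))
      (≤-linear O
        (+-mono-≤ (+-mono-≤ hyp₀ hyp₀) digit-upper)
        (solve 7 (λ u d p q p′ q′ r →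
          u :+ u :+ r :+ q′ :+
            ((p :+ d) :+ (p :+ d) :+ (p′ :+ con 2 :* q :+ con 1)) :+ con 0 :=
          p′ :+ (d :+ d :+ con 1) :+
            ((u :+ q) :+ (u :+ q) :+ (r :+ (con 2 :* p :+ q′)))) ≈-refl′
          (up γ v0) (down γ v0) (v2 · v0) (v1 · v0)
          (v2 · (Suc · v0)) (v1 · (Suc · v0)) r)))))))
  where
  open Solver
  γ : Tm (𝟘 ∷ 𝟙 ∷ 𝟙 ∷ Γ) 𝟙
  γ = digitsₜ v2 v1
  r x y : Tm (𝟘 ∷ 𝟙 ∷ 𝟙 ∷ Γ) 𝟘
  r = minₒ (γ · (Suc · v0)) (numeral 2)
  x = v2 · (Suc · v0) +ₒ numeral 2 *ₒ (v1 · v0) +ₒ numeral 1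
  y = numeral 2 *ₒ (v2 · v0) +ₒ v1 · (Suc · v0)
  digit-upper : ∀ {B H} → 𝟘 ∷ 𝟙 ∷ 𝟙 ∷ Γ ∣
    B ∷ ∀̇ 𝟘 (numeral 2 *ₒ (v3 · v0) +ₒ v2 · (Suc · v0) ≤₀
       v3 · (Suc · v0) +ₒ numeral 2 *ₒ (v2 · v0) +ₒ numeral 1) ∷ H
    ⊢ r +ₒ y ≤₀ x
  digit-upper = ≤-trans
    (+-mono-≤ (≤-trans (m∸n≤m _ _) (≤-reflexive (digits-Suc _ _ _))) ≤-refl)
    (≤-reflexive (≈-trans (+-comm _ _)
      (≈-sym (≤⇒+ (∀E hyp₁ v0)))))

-- Sums of reals

sumUp sumDown : Tm Γ 𝟙 → Tm Γ 𝟙 → Tm Γ 𝟘 → Tm Γ 𝟘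
sumUp   α β n = up   α (Suc · (Suc · n)) +ₒ up   β (Suc · (Suc · n))
sumDown α β n = down α (Suc · (Suc · n)) +ₒ down β (Suc · (Suc · n))

sumFloor : Tm Γ 𝟙 → Tm Γ 𝟙 → Tm Γ 𝟘 → Tm Γ 𝟘
sumFloor α β n =
  ⌊ sumUp α β n +ₒ numeral 3 *ₒ sumDown α β n +ₒ numeral 2 /suc numeral 3 ⌋

sumᴿ∼digits : _∼_ {Γ = 𝟘 ∷ 𝟙 ∷ 𝟙 ∷ Γ} (v2 +ᴿ v1)
  (digitsₜ (ƛ (sumFloor v3 v2 v0)) (ƛ (sumDown v3 v2 v0)))
sumᴿ∼digits = ∼-trans
  (·-∼ (β (ƛ (digitsₜ (ƛ (sumFloor v2 v1 v0)) (ƛ (sumDown v2 v1 v0)))) v2)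
    ∼-refl)
  (β (digitsₜ (ƛ (sumFloor v4 v1 v0)) (ƛ (sumDown v4 v1 v0))) v1)

-- From 4f ≤ u + 3w + 2 follows 8f + 4 ≤ 2u + 6w + 8, and the next numerator exceeds this by the two
-- new digits. As w becomes 2w + 2, the premise of `digits-upper` results for A = f - w.
sumFloor-Suc : (α β : Tm Γ 𝟙) (n : Tm Γ 𝟘) → Γ ∣ H ⊢
  numeral 2 *ₒ sumFloor α β n +ₒ numeral 1 ≤₀ sumFloor α β (Suc · n)
sumFloor-Suc α β n = ≤-quot (≤-cong ≈-refl′
  (+-cong (+-cong
    (≈-sym (+-cong (up-Suc α n″) (up-Suc β n″)))
    (*-cong ≈-refl′ (≈-sym (+-cong (down-Suc α n″) (down-Suc β n″))))) ≈-refl′)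
  (≤-linear (r +ₒ s) (+-mono-≤ f≤ f≤)
    (solve 7 (λ f a b r s x y →
       (con 2 :* f :+ con 1) :* (con 3 :+ con 1) :+
       ((a :+ b :+ con 3 :* (x :+ y) :+ con 2) :+
        (a :+ b :+ con 3 :* (x :+ y) :+ con 2)) :+ (r :+ s) :=
       (a :+ a :+ r) :+ (b :+ b :+ s) :+
       con 3 :* ((x :+ x :+ con 1) :+ (y :+ y :+ con 1)) :+ con 2 :+
       (f :* (con 3 :+ con 1) :+ f :* (con 3 :+ con 1))) ≈-refl′
      (sumFloor α β n) (up α n″) (up β n″) r s (down α n″) (down β n″))))
  where
  open Solver
  n″ r s : Tm _ 𝟘
  n″ = Suc · (Suc · n)
  r = minₒ (α · (Suc · n″)) (numeral 2)
  s = minₒ (β · (Suc · n″)) (numeral 2)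
  f≤ : _ ∣ _ ⊢ sumFloor α β n *ₒ (numeral 3 +ₒ numeral 1) ≤₀
    sumUp α β n +ₒ numeral 3 *ₒ sumDown α β n +ₒ numeral 2
  f≤ = ∧E₁ (quot-bounds _ _)

sumDown-Suc : (α β : Tm Γ 𝟙) (n : Tm Γ 𝟘) → Γ ∣ H ⊢
  sumDown α β (Suc · n) ≈ numeral 2 *ₒ sumDown α β n +ₒ numeral 2
sumDown-Suc α β n = ≈-trans (+-cong (down-Suc α _) (down-Suc β _))
  (solve 2 (λ x y → (x :+ x :+ con 1) :+ (y :+ y :+ con 1) :=
    con 2 :* (x :+ y) :+ con 2) ≈-refl′ _ _)
  where open Solver

sum-upper : (α β : Tm Γ 𝟙) (n : Tm Γ 𝟘) → Γ ∣ H ⊢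
  up (α +ᴿ β) n +ₒ sumDown α β n ≤₀ sumFloor α β n +ₒ down (α +ᴿ β) n
sum-upper {Γ = Γ} = ∀E₃ {A = up (v2 +ᴿ v1) v0 +ₒ sumDown v2 v1 v0 ≤₀
    sumFloor v2 v1 v0 +ₒ down (v2 +ᴿ v1) v0} (∀I (∀I (∀I
  (≤-cong
    (+-cong (≈-sym (∼⇒≈ (·-∼ (·-∼ ∼-refl sumᴿ∼digits) ∼-refl))) (Q· v0))
    (+-cong (P· v0) (≈-sym (∼⇒≈ (·-∼ (·-∼ ∼-refl sumᴿ∼digits) ∼-refl))))
    (∀E (⊃E (digits-upper (ƛ (sumFloor v3 v2 v0)) (ƛ (sumDown v3 v2 v0)))
      (∀I (≤-cong
        (+-cong (*-cong ≈-refl′ (≈-sym (P′· v0)))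
                (≈-sym (≈-trans (Q′· (Suc · v0)) (sumDown-Suc _ _ _))))
        (+-cong (+-cong (≈-sym (P′· (Suc · v0)))
                        (*-cong ≈-refl′ (≈-sym (Q′· v0)))) ≈-refl′)
        (≤-linear O (sumFloor-Suc _ _ _)
          (solve 3 (λ f f′ w →
            con 2 :* f :+ (con 2 :* w :+ con 2) :+ f′ :+ con 0 :=
            f′ :+ con 2 :* w :+ con 1 :+ (con 2 :* f :+ con 1)) ≈-refl′
            _ _ _)))))
      v0)))))
  where
  open Solver
  P· : ∀ {H} (n : Tm (𝟘 ∷ 𝟙 ∷ 𝟙 ∷ Γ) 𝟘) → _ ∣ H ⊢
       ƛ (sumFloor v3 v2 v0) · n ≈ sumFloor v2 v1 n
  P· n = ∼⇒≈ (β (sumFloor v3 v2 v0) n)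
  Q· : ∀ {H} (n : Tm (𝟘 ∷ 𝟙 ∷ 𝟙 ∷ Γ) 𝟘) → _ ∣ H ⊢
       ƛ (sumDown v3 v2 v0) · n ≈ sumDown v2 v1 n
  Q· n = ∼⇒≈ (β (sumDown v3 v2 v0) n)
  P′· : ∀ {H} (n : Tm (𝟘 ∷ 𝟘 ∷ 𝟙 ∷ 𝟙 ∷ Γ) 𝟘) → _ ∣ H ⊢
        ƛ (sumFloor v4 v3 v0) · n ≈ sumFloor v3 v2 n
  P′· n = ∼⇒≈ (β (sumFloor v4 v3 v0) n)
  Q′· : ∀ {H} (n : Tm (𝟘 ∷ 𝟘 ∷ 𝟙 ∷ 𝟙 ∷ Γ) 𝟘) → _ ∣ H ⊢
        ƛ (sumDown v4 v3 v0) · n ≈ sumDown v3 v2 n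
  Q′· n = ∼⇒≈ (β (sumDown v4 v3 v0) n)

-- Growth of partial sums, and representations beginning with zeros

up-Suc-≤ : (γ : Tm Γ 𝟙) (n : Tm Γ 𝟘) → Γ ∣ H ⊢
  up γ (Suc · n) ≤₀ numeral 2 *ₒ up γ n +ₒ numeral 2
up-Suc-≤ γ n = ≤-cong (≈-sym (up-Suc γ n)) ≈-refl′
  (≤-linear O (minₒ≤ʳ (γ · (Suc · n)) (numeral 2))
    (solve 2 (λ u r → u :+ u :+ r :+ con 2 :+ con 0 := con 2 :* u :+ con 2 :+ r)
      ≈-refl′ _ _))
  where open Solver

-- Each digit is at most 2, so three of them contribute at most 2(4 + 2 + 1) = 14. As `down` gains
-- exactly 4 + 2 + 1, together P(n+3) ≤ 8P(n) + 7.
up-Suc³-≤ : (γ : Tm Γ 𝟙) (n : Tm Γ 𝟘) → Γ ∣ H ⊢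
  up γ (Suc · (Suc · (Suc · n))) ≤₀ numeral 8 *ₒ up γ n +ₒ numeral 14
up-Suc³-≤ γ n = ≤-linear O
  (+-mono-≤ (+-mono-≤ (up-Suc-≤ γ (Suc · (Suc · n)))
    (*-monoˡ-≤ (numeral 2) (up-Suc-≤ γ (Suc · n))))
    (*-monoˡ-≤ (numeral 4) (up-Suc-≤ γ n)))
  (solve 4 (λ a b c e →
    e :+ (con 2 :* c :+ con 2 :+ (con 2 :* b :+ con 2) :* con 2 :+
      (con 2 :* a :+ con 2) :* con 4) :+ con 0 :=
    con 8 :* a :+ con 14 :+ (e :+ c :* con 2 :+ b :* con 4)) ≈-refl′ _ _ _ _)
  where open Solver

down-Suc³ : (γ : Tm Γ 𝟙) (n : Tm Γ 𝟘) → Γ ∣ H ⊢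
  down γ (Suc · (Suc · (Suc · n))) ≈ numeral 8 *ₒ down γ n +ₒ numeral 7
down-Suc³ γ n = ≈-trans (step _ (step _ (down-Suc γ n)))
  (solve 1 (λ d → let d₁ = d :+ d :+ con 1 ; d₂ = d₁ :+ d₁ :+ con 1 in
    d₂ :+ d₂ :+ con 1 := con 8 :* d :+ con 7) ≈-refl′ _)
  where
  open Solver
  step : ∀ {H} m {a} → _ ∣ H ⊢ down γ m ≈ a →
         _ ∣ H ⊢ down γ (Suc · m) ≈ a +ₒ a +ₒ numeral 1
  step m p = ≈-trans (down-Suc γ m) (+-cong (+-cong p p) ≈-refl′)

-- The digit 0 is coded as 1 and adds 1 to both `up` and `down`. A vanishing partial sum therefore
-- shows as equality of the two, not as both being 0.
digits-zero : (p q : Tm Γ 𝟙) (N : Tm Γ 𝟘) → Γ ∣ H ⊢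
  ∀≤ N (wkᵗ p · v0 ≈ O ∧̇ wkᵗ q · v0 ≈ O) ⊃
  ∀≤ N (up (digitsₜ (wkᵗ p) (wkᵗ q)) v0 ≈ down (digitsₜ (wkᵗ p) (wkᵗ q)) v0)
digits-zero {Γ = Γ} = ∀E₃ {A = ∀≤ v0 (v3 · v0 ≈ O ∧̇ v2 · v0 ≈ O) ⊃
  ∀≤ v0 (up (digitsₜ v3 v2) v0 ≈ down (digitsₜ v3 v2) v0)}
  (∀I (∀I (∀I (⊃I (ind
    (⊃I (≈-trans
      (≈-trans (up-O _) (≈-trans (·-cong (closed posPart) digit-O) parts-0))
      (≈-sym (≈-trans (down-O _) (·-cong (closed negPart) digit-O)))))
    (⊃I (≈-trans (up-Suc γ v0) (≈-trans
      (+-cong (+-cong ih ih) (≈-trans (∸-cong digit-Suc (∸-cong digit-Suc ≈-refl′))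
        (compute refl)))
      (≈-sym (down-Suc γ v0))))))))))
  where
  γ : Tm (𝟘 ∷ 𝟘 ∷ 𝟙 ∷ 𝟙 ∷ Γ) 𝟙
  γ = digitsₜ v3 v2
  parts-0 : ∀ {Γ H} → Γ ∣ H ⊢
    closed posPart · code O O ≈ closed negPart · code O O
  parts-0 = compute refl
  hypothesis : Form (𝟘 ∷ 𝟙 ∷ 𝟙 ∷ Γ)
  hypothesis = ∀≤ v0 (v3 · v0 ≈ O ∧̇ v2 · v0 ≈ O)
  digit-O : ∀ {H} → 𝟘 ∷ 𝟙 ∷ 𝟙 ∷ Γ ∣ (O ≤₀ v0) ∷ hypothesis ∷ H ⊢
            digitsₜ v2 v1 · O ≈ code O O
  digit-O = ≈-trans (digits-O _ _)
    (+-cong (*-cong ≈-refl′ (∸-cong (∧E₁ z) (∧E₂ z)))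
      (∸-cong (*-cong ≈-refl′ (∸-cong (∧E₂ z) (∧E₁ z))) ≈-refl′))
    where
    z = ⊃E (∀E hyp₁ O) 0≤n
  Hyps : List (Form (𝟘 ∷ 𝟘 ∷ 𝟙 ∷ 𝟙 ∷ Γ)) → List (Form (𝟘 ∷ 𝟘 ∷ 𝟙 ∷ 𝟙 ∷ Γ))
  Hyps H = (Suc · v0 ≤₀ v1) ∷ (v0 ≤₀ v1 ⊃ up γ v0 ≈ down γ v0) ∷
    wk hypothesis ∷ H
  n≤N : ∀ {H} → _ ∣ Hyps H ⊢ v0 ≤₀ v1
  n≤N = m+1≤n⇒m≤n (≤-cong (≈-sym (+1≈Suc _)) ≈-refl′ hyp₀)
  ih : ∀ {H} → _ ∣ Hyps H ⊢ up γ v0 ≈ down γ v0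
  ih = ⊃E hyp₁ n≤N
  digit-Suc : ∀ {H} → _ ∣ Hyps H ⊢ γ · (Suc · v0) ≈
    (O +ₒ numeral 2 *ₒ O +ₒ numeral 1) ∸ₒ (numeral 2 *ₒ O +ₒ O)
  digit-Suc = ≈-trans (digits-Suc _ _ _) (∸-cong
    (+-cong (+-cong (∧E₁ z′) (*-cong ≈-refl′ (∧E₂ z))) ≈-refl′)
    (+-cong (*-cong ≈-refl′ (∧E₁ z)) (∧E₂ z′)))
    where
    z  = ⊃E (∀E hyp₂ v0) n≤N
    z′ = ⊃E (∀E hyp₂ (Suc · v0)) hyp₀

0ᴿ-partial : (n : Tm Γ 𝟘) → Γ ∣ H ⊢ up 0ᴿ n ≈ down 0ᴿ n
0ᴿ-partial {Γ} = ∀E {A = up 0ᴿ v0 ≈ down 0ᴿ v0} (∀I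
  (≈-trans (∼⇒≈ (·-∼ (·-∼ ∼-refl 0ᴿ∼digits) ∼-refl)) (≈-trans
    (⊃E (∀E (⊃E (digits-zero (ƛ (O *ₒ closed pow2 · v0)) (ƛ O) v0)
      (∀I (⊃I (∧I
        (≈-trans (∼⇒≈ (β (O *ₒ closed pow2 · v0) v0)) (*-zeroˡ _))
        (∼⇒≈ (β O v0)))))) v0) ≤-refl)
    (≈-sym (∼⇒≈ (·-∼ (·-∼ ∼-refl 0ᴿ∼digits) ∼-refl))))))
  where
  0ᴿ∼digits : _∼_ {Γ = 𝟘 ∷ Γ} 0ᴿ (digitsₜ (ƛ (O *ₒ closed pow2 · v0)) (ƛ O))
  0ᴿ∼digits = β (digitsₜ (ƛ (v1 *ₒ closed pow2 · v0)) (ƛ O)) O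

pow2-Suc : (n : Tm Γ 𝟘) → Γ ∣ H ⊢
  closed pow2 · (Suc · n) ≈ closed pow2 · n +ₒ closed pow2 · n
pow2-Suc = ∀E {A =
  closed pow2 · (Suc · v0) ≈ closed pow2 · v0 +ₒ closed pow2 · v0}
  (∀I (compute refl))

pow2-mono-≤ : Γ ∣ H ⊢ m ≤₀ n → Γ ∣ H ⊢ closed pow2 · m ≤₀ closed pow2 · n
pow2-mono-≤ {m = m} {n = n} p =
  ≤-cong ≈-refl′ (·-cong (closed pow2) (≈-sym (≤⇒+ p))) (pow2≤ m (n ∸ₒ m))
  where
  pow2≤ : ∀ {Γ H} (m n : Tm Γ 𝟘) →
          Γ ∣ H ⊢ closed pow2 · m ≤₀ closed pow2 · (m +ₒ n)
  pow2≤ = ∀E₂ {A = closed pow2 · v1 ≤₀ closed pow2 · (v1 +ₒ v0)} (∀I (ind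
    (≤-reflexive (·-cong (closed pow2) (≈-sym (+-identityʳ _))))
    (≤-trans hyp₀ (≤-trans (m≤m+n _ _)
      (≤-reflexive (≈-sym (≈-trans (·-cong (closed pow2) (+-Suc _ _))
        (pow2-Suc _))))))))

-- For every i ≤ n, 2^i ≤ 2^n ≤ r makes ⌊2^i/(r+1)⌋ zero, so `digits-zero` applies up to n.
1/suc-partial : (r n : Tm Γ 𝟘) → Γ ∣ H ⊢ closed pow2 · n ≤₀ r →
                Γ ∣ H ⊢ up (1/suc r) n ≈ down (1/suc r) n
1/suc-partial {Γ} r n p = ⊃E (∀E₂ {A = closed pow2 · v0 ≤₀ v1 ⊃
    up (1/suc v1) v0 ≈ down (1/suc v1) v0} (∀I (∀I (⊃I
  (≈-trans (∼⇒≈ (·-∼ (·-∼ ∼-refl 1/suc∼digits) ∼-refl)) (≈-trans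
    (⊃E (∀E (⊃E (digits-zero (ƛ ⌊ closed pow2 · v0 /suc v2 ⌋) (ƛ O) v0)
      (∀I (⊃I (∧I
        (≈-trans (∼⇒≈ (β ⌊ closed pow2 · v0 /suc v3 ⌋ v0))
          (quot-small (≤-trans (pow2-mono-≤ hyp₀) hyp₁)))
        (∼⇒≈ (β O v0)))))) v0) ≤-refl)
    (≈-sym (∼⇒≈ (·-∼ (·-∼ ∼-refl 1/suc∼digits) ∼-refl)))))))) r n) p
  where
  1/suc∼digits : _∼_ {Γ = 𝟘 ∷ 𝟘 ∷ Γ} (1/suc v1)
    (digitsₜ (ƛ ⌊ closed pow2 · v0 /suc v2 ⌋) (ƛ O))
  1/suc∼digits = β (digitsₜ (ƛ ⌊ closed pow2 · v0 /suc v1 ⌋) (ƛ O)) v1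

-- Comparison at a fixed precision and nonnegativity of d

LeAt LtAt : Tm Γ 𝟙 → Tm Γ 𝟙 → Tm Γ 𝟘 → Form Γ
LeAt α β n = up α n +ₒ down β n ≤₀ up β n +ₒ down α n +ₒ numeral 2
LtAt α β n = up α n +ₒ down β n +ₒ numeral 2 <₀ up β n +ₒ down α n

-- An n-th partial sum of α below -2 is at most -17 three digits later, whereas
-- α ≈ β and α + β ≥ -4 (in units of 2^-(n+1)) leave at least -10 there.
sum≥-4⇒≥-2 : (α β : Tm Γ 𝟙) (n : Tm Γ 𝟘) →
  let n₁ = Suc · n ; n₃ = Suc · (Suc · n₁) in
  Γ ∣ H ⊢ down (α +ᴿ β) n₁ ≤₀ up (α +ᴿ β) n₁ +ₒ numeral 4 →
  Γ ∣ H ⊢ LeAt β α n₃ →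
  Γ ∣ H ⊢ down α n ≤₀ up α n +ₒ numeral 2
-- For twice the partial sum, the bounds -34 and -20 clash by 14: 1 for the goal 1 ≤ 0 and 13 as
-- slack. The multiplier 16 is this factor 2 times 2^3.
sum≥-4⇒≥-2 {Γ = Γ} {H = H} α β n p q = ≤-by-contradiction (≤-linear (numeral 13)
  (+-mono-≤
    (+-mono-≤ (weaken there 2α≥-20) (*-monoˡ-≤ (numeral 2) (up-Suc³-≤ α n)))
    (*-monoˡ-≤ (numeral 16) hyp₀))
  (≈-trans
    (solve 3 (λ u d u₃ →
      con 1 :+ (con 2 :* u₃ :+ con 20 :+
        (con 8 :* u :+ con 14) :* con 2 :+ d :* con 16) :+ con 13 :=
      con 0 :+ (con 2 :* (con 8 :* d :+ con 7) :+ u₃ :* con 2 :+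
        (u :+ con 2 :+ con 1) :* con 16)) ≈-refl′
      (up α n) (down α n) (up α n₃))
    (+-cong ≈-refl′ (+-cong (+-cong
      (*-cong ≈-refl′ (≈-sym (down-Suc³ α n))) ≈-refl′) ≈-refl′))))
  where
  open Solver
  n₁ n₃ w u : Tm Γ 𝟘
  n₁ = Suc · n
  n₃ = Suc · (Suc · n₁)
  w = sumDown α β n₁
  u = sumUp α β n₁
  w≤f+4 : Γ ∣ H ⊢ w ≤₀ sumFloor α β n₁ +ₒ numeral 4
  w≤f+4 = ≤-linear O (+-mono-≤ p (sum-upper α β n₁))
    (solve 4 (λ w f s t → w :+ (s :+ con 4 :+ (f :+ t)) :+ con 0 :=
      f :+ con 4 :+ (t :+ (s :+ w))) ≈-refl′
      w (sumFloor α β n₁) (up (α +ᴿ β) n₁) (down (α +ᴿ β) n₁))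
  -- 18 = 4 · 4 + 2: the tolerance 4 times the divisor, plus the rounding summand.
  w≤u+18 : Γ ∣ H ⊢ w ≤₀ u +ₒ numeral 18
  w≤u+18 = ≤-linear O
    (+-mono-≤ (*-monoˡ-≤ (numeral 4) w≤f+4) (∧E₁ (quot-bounds (numeral 3) _)))
    (solve 3 (λ w f u →
      w :+ ((f :+ con 4) :* con 4 :+ (u :+ con 3 :* w :+ con 2)) :+ con 0 :=
      u :+ con 18 :+ (w :* con 4 :+ f :* (con 3 :+ con 1))) ≈-refl′
      w (sumFloor α β n₁) u)
  2α≥-20 : Γ ∣ H ⊢ numeral 2 *ₒ down α n₃ ≤₀ numeral 2 *ₒ up α n₃ +ₒ numeral 20
  2α≥-20 = ≤-linear O (+-mono-≤ w≤u+18 q)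
    (solve 4 (λ a x b y →
      con 2 :* x :+ (a :+ b :+ con 18 :+ (a :+ y :+ con 2)) :+ con 0 :=
      con 2 :* a :+ con 20 :+ (x :+ y :+ (b :+ x))) ≈-refl′
      (up α n₃) (down α n₃) (up β n₃) (down β n₃))

axᴹ : {A : Form Γ} → 𝒯ᴹ A → Γ ∣ H ⊢ A
axᴹ p = axiom (base p)

-- The triangle inequality along x, y, x bounds d (x , y) + d (y , x) below by d (x , x), and
-- symmetry divides this between the summands. The tolerance 2 is the one in the matrix of 0 ≤ d (x
-- , y).
d-nonneg : (x y : Tm Γ 𝕏) (n : Tm Γ 𝟘) → Γ ∣ H ⊢
  down (𝐝 · x · y) n ≤₀ up (𝐝 · x · y) n +ₒ numeral 2
d-nonneg {Γ = Γ} = ∀E₃ {A = down (𝐝 · v2 · v1) v0 ≤₀ up (𝐝 · v2 · v1) v0 +ₒ numeral 2}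
  (∀I (∀I (∀I (sum≥-4⇒≥-2 (𝐝 · v2 · v1) (𝐝 · v1 · v2) v0
    -- The 4 is 2 for 0 ≤ d (x , x) plus 2 for the triangle inequality.
    (≤-linear O
      (+-mono-≤ dxx≥0 (∀E (∀E (∀E (∀E (axᴹ d-tri) v2) v1) v2) (Suc · v0)))
      (solve 5 (λ u w a b z →
        w :+ (a :+ z :+ con 2 :+ (u :+ b :+ con 2)) :+ con 0 :=
        u :+ con 4 :+ (z :+ b :+ (a :+ w))) ≈-refl′
        (up loop n₁) (down loop n₁) (up xx n₁) (down xx n₁) (down 0ᴿ n₁)))
    (∧E₂ (∀E (∀E (∀E (axᴹ d-sym) v2) v1) (Suc · (Suc · (Suc · v0)))))))))
  where
  open Solver
  n₁ : Tm (𝟘 ∷ 𝕏 ∷ 𝕏 ∷ Γ) 𝟘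
  n₁ = Suc · v0
  loop xx : Tm (𝟘 ∷ 𝕏 ∷ 𝕏 ∷ Γ) 𝟙
  loop = 𝐝 · v2 · v1 +ᴿ 𝐝 · v1 · v2
  xx = 𝐝 · v2 · v2
  dxx≥0 : ∀ {H} → 𝟘 ∷ 𝕏 ∷ 𝕏 ∷ Γ ∣ H ⊢
    down 0ᴿ n₁ +ₒ down xx n₁ ≤₀ up xx n₁ +ₒ down 0ᴿ n₁ +ₒ numeral 2
  dxx≥0 = ≤-cong (+-cong (0ᴿ-partial _) ≈-refl′) ≈-refl′
    (∧E₂ (∀E (∀E (axᴹ d-refl) v2) n₁))

EqAt : Tm Γ 𝟙 → Tm Γ 𝟙 → Tm Γ 𝟘 → Form Γ
EqAt α β n = LeAt α β n ∧̇ LeAt β α n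

-- At precision n the partial sums of 1/(r+1) and of 0 are both zero, so the upper half carries over
-- without loss; the lower half is `d-nonneg`.
small⇒EqAt-0 : (x y : Tm Γ 𝕏) (r n : Tm Γ 𝟘) →
  Γ ∣ H ⊢ closed pow2 · n ≤₀ r → Γ ∣ H ⊢ LeAt (𝐝 · x · y) (1/suc r) n →
  Γ ∣ H ⊢ EqAt (𝐝 · x · y) 0ᴿ n
small⇒EqAt-0 x y r n p q = ∧I
  (≤-cong ≈-refl′ (+-cong (+-cong (≈-sym (0ᴿ-partial n)) ≈-refl′) ≈-refl′)
    (≤-linear O
      (≤-cong ≈-refl′ (+-cong (+-cong (1/suc-partial r n p) ≈-refl′) ≈-refl′) q)
      (solve 4 (λ u d z e →
        u :+ z :+ (e :+ d :+ con 2) :+ con 0 := z :+ d :+ con 2 :+ (u :+ e))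
        ≈-refl′ (up δ n) (down δ n) (down 0ᴿ n) (down (1/suc r) n))))
  (≤-cong (+-cong (≈-sym (0ᴿ-partial n)) ≈-refl′) ≈-refl′
    (≤-linear O (d-nonneg x y n)
      (solve 3 (λ u d z →
        z :+ d :+ (u :+ con 2) :+ con 0 := u :+ z :+ con 2 :+ d)
        ≈-refl′ (up δ n) (down δ n) (down 0ᴿ n))))
  where
  open Solver
  δ : Tm _ 𝟙
  δ = 𝐝 · x · y

-- The collection argument

Approx : Tm Γ (𝕏 ⇒ 𝕏) → Tm Γ 𝟘 → Tm Γ 𝟙 → Tm Γ (𝕏 ⇒ 𝟙) → Tm Γ 𝕏 → Tm Γ 𝟘 →
         Form Γ
Approx U k l θ y n =
  EqAt (𝐝 · (U · y) · y) 0ᴿ n ⊃ LtAt l (θ · y +ᴿ 1/suc k) n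

v6 : ∀ {τ τ₀ τ₁ τ₂ τ₃ τ₄ τ₅} → Tm (τ₀ ∷ τ₁ ∷ τ₂ ∷ τ₃ ∷ τ₄ ∷ τ₅ ∷ τ ∷ Γ) τ
v6 = wkᵗ v5

v7 : ∀ {τ τ₀ τ₁ τ₂ τ₃ τ₄ τ₅ τ₆} →
     Tm (τ₀ ∷ τ₁ ∷ τ₂ ∷ τ₃ ∷ τ₄ ∷ τ₅ ∷ τ₆ ∷ τ ∷ Γ) τ
v7 = wkᵗ v6

Params : Ctx
Params = 𝕏 ⇒ 𝟙 ∷ 𝟙 ∷ 𝟘 ∷ 𝟘 ⇒ 𝕏 ∷ 𝕏 ⇒ 𝕏 ∷ []

-- The quantifier is vacuous; it makes the formula a Σ-formula.
Matrix : Form (𝟘 ∷ 𝕏 ∷ Params)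
Matrix = ∃̇ 𝟘 (Approx v7 v5 v4 v3 v2 v1)

Matrix-Σ : IsΣ Matrix
Matrix-Σ = isΣ (imp (conj (eq _ _) (eq _ _)) (eq _ _))

FixHyp : Form Params
FixHyp = ∀̇ 𝕏 (v0 ∈Fix v5 ⊃ v2 <ᴿ v1 · v0 +ᴿ 1/suc v3)

-- If `Approx` failed for every n, its premise would hold for every n, which makes y a fixed point;
-- the index then witnessing λ < θ (y) + 1/(k+1) satisfies `Approx` after all.
Matrix-total : Params ∣ FixHyp ∷ H ⊢ ∀̇ 𝕏 (∃̇ 𝟘 Matrix)
Matrix-total = ∀I (raa (∃E (⊃E (∀E hyp₁ v0)
    (∀I (raa (⊃E hyp₁
      -- Where the premise fails, `Approx` holds vacuously; `O` fills the dummy quantifier.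
      (∃I v0 (∃I O (⊃I (⊥E (⊃E hyp₁ hyp₀)))))))))
  (⊃E hyp₁ (∃I v0 (∃I O (⊃I hyp₁))))))

proposition4p1 : 𝒯ᴹ⁺ ⊢ ∀̇ (𝕏 ⇒ 𝕏) (∀̇ (𝟘 ⇒ 𝕏) (
    ∀̇ 𝟘 (∃̇ 𝟘 (∀̇ 𝟘 (v1 ≤₀ v0 ⊃ 𝐝 · (v4 · (v3 · v0)) · (v3 · v0) ≤ᴿ 1/suc v2)))
    ⊃ ∀̇ 𝟘 (∀̇ 𝟙 (∀̇ (𝕏 ⇒ 𝟙) (
    ∀̇ 𝕏 (v0 ∈Fix v5 ⊃ v2 <ᴿ v1 · v0 +ᴿ 1/suc v3)
    ⊃ ∃̇ 𝟘 (∀̇ 𝟘 (v1 ≤₀ v0 ⊃ v3 <ᴿ v2 · (v5 · v0) +ᴿ 1/suc v4)))))))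
proposition4p1 = ∀I (∀I (⊃I (∀I (∀I (∀I (⊃I
  (∃E (⊃E (axiom (collX Matrix Matrix-Σ)) Matrix-total)
  -- N is known here and no index of the sequence has been chosen yet, so r = 2^N is available to
  -- the limit hypothesis.
  (∃E (∀E hyp₂ (closed pow2 · v0))
  (∃I v0 (∀I (⊃I
  (∃E (∀E hyp₂ (v6 · v0))
  (∃E (∧E₂ hyp₀)
  -- The index j ≤ N that collection gives for u m is itself the witness of `<ᴿ`; 2^j ≤ 2^N = r
  -- makes 1/(r+1) indistinguishable from 0 at j.
  (∃I v1 (⊃E hyp₀
    (small⇒EqAt-0 (v9 · (v8 · v2)) (v8 · v2) (closed pow2 · v4) v1
      (pow2-mono-≤ (∧E₁ hyp₁))
      (∀E (⊃E (∀E hyp₃ v2) hyp₂) v1)))))))))))))))))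
  where
  v8 : Tm (𝟘 ∷ 𝟘 ∷ 𝟘 ∷ 𝟘 ∷ 𝟘 ∷ Params) (𝟘 ⇒ 𝕏)
  v8 = wkᵗ v7
  v9 : Tm (𝟘 ∷ 𝟘 ∷ 𝟘 ∷ 𝟘 ∷ 𝟘 ∷ Params) (𝕏 ⇒ 𝕏)
  v9 = wkᵗ (wkᵗ v7)
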